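{- Let $n\ge1$. Then $$LG^R(n,2n)=\Big\{X\in Gr(n,2n): \Delta_I(X)=\Delta_{\mathcal R(I)}(X)\ \text{ for all } I\in\tbinom{[2n]}{n}\Big\}.$$ Similarly, $$LG^R_{\ge0}(n,2n)=\Big\{X\in Gr(n,2n): \Delta_I(X)=\Delta_{\mathcal R(I)}(X)\ge 0\ \text{ for all } I\in\tbinom{[2n]}{n}\Big\}.$$
   Context: $Gr(n,2n)$ is the real Grassmannian of $n$-dimensional subspaces of $\mathbb R^{2n}$; $\Delta_I(X)$, for $I\in\binom{[2n]}{n}=\{I\subset\{1,\dots,2n\}:|I|=n\}$, are the Plücker coordinates (maximal minors of a representing $n\times 2n$ matrix), defined up to common rescaling (inequalities $\Delta_I\ge0$ are understood for a suitable choice of scaling). $Gr_{\ge0}(n,2n)$ is the set of $X$ with all Plücker coordinates nonnegative. $R(x,y)=\sum_{i=1}^n(-1)^{i-1}(x_iy_{n+i}-x_{n+i}y_i)$; $LG^R(n,2n)=\{X\in Gr(n,2n):R(x,y)=0\ \forall x,y\in X\}$; $LG^R_{\ge0}(n,2n)=LG^R(n,2n)\cap Gr_{\ge0}(n,2n)$. For $I\in\binom{[2n]}{n}$, $\mathcal R(I)=\rho([2n]\setminus I)$, where $\rho(i)=i+n \bmod 2n$ on $[2n]$. -}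

module Defs where

open import Level using (Level; _⊔_) renaming (suc to lsuc)
open import Algebra.Apartness.Bundles using (HeytingField; HeytingCommutativeRing)
open import Algebra.Bundles using (CommutativeRing; Semiring)
import Algebra.Definitions.RawSemiring as RawSemiringDefinitions
open import Data.Fin.Base using (Fin; zero; suc; toℕ; cast; punchIn; splitAt; _↑ˡ_; _↑ʳ_)
open import Data.Fin.Properties
  using (toℕ<n; toℕ-fromℕ<; toℕ-↑ˡ; toℕ-↑ʳ; toℕ-injective; any?; join-splitAt)
  renaming (_≟_ to _≟ᶠ_)
open import Data.Fin.Subset using (Subset; inside; outside; ∁; ∣_∣)
open import Data.Fin.Subset.Properties using (_∈?_; ∣∁p∣≡n∸∣p∣)
open import Data.Nat.Base as ℕ using (ℕ; zero; suc; NonZero)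
open import Data.Nat.DivMod using (_%_; _mod_; m%n<n; m<n⇒m%n≡m; [m+n]%n≡m%n)
import Data.Nat.Properties as ℕₚ
open import Data.Product.Base using (Σ; ∃; _×_; _,_)
open import Data.Sum.Base using (_⊎_; inj₁; inj₂)
open import Data.Vec.Base using (_∷_; tabulate; lookup)
open import Data.Vec.Functional using (Vector)
open import Data.Vec.Properties using (tabulate-cong; tabulate∘lookup; []=⇒lookup; lookup⇒[]=)
open import Function.Base using (_∘_)
open import Function.Bundles using (_⇔_)
open import Relation.Binary.Core using (Rel)
open import Relation.Binary.PropositionalEquality
  using (_≡_; refl; sym; trans; cong; cong₂; module ≡-Reasoning)
open import Relation.Binary.Structures using (IsStrictPartialOrder)
open import Relation.Nullary using (¬_; does; yes; no; contradiction)
open import Relation.Nullary.Decidable using (_×-dec_)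
open import Relation.Unary using (Pred) renaming (_∩_ to _∩ᵖ_)

------------------------------------------------------------------------
-- The real numbers, characterised as the Archimedean, Cauchy-complete
-- ordered field.  The axioms are phrased so that they hold both for the
-- classical real line and for the constructive (Bishop) reals; read
-- classically they have ℝ as their only model up to isomorphism, with
-- _#_ being ≉ and _≤_ the usual order.

record RealNumbers (c ℓ₁ ℓ₂ : Level) : Set (lsuc (c ⊔ ℓ₁ ⊔ ℓ₂)) where
  infix 4 _<_ _≤_

  field
    heytingField : HeytingField c ℓ₁ ℓ₂

  open HeytingField heytingField public
    hiding (heytingCommutativeRing; isHeytingField)

  commutativeRing : CommutativeRing c ℓ₁
  commutativeRing = HeytingCommutativeRing.commutativeRing
    (HeytingField.heytingCommutativeRing heytingField)

  open RawSemiringDefinitions (Semiring.rawSemiring (CommutativeRing.semiring commutativeRing)) public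
    using (sum; _^_) renaming (_×_ to _×ⁿ_)

  field
    _<_                  : Rel Carrier ℓ₂
    isStrictPartialOrder : IsStrictPartialOrder _≈_ _<_
    #⇔<⊎>                : ∀ x y → (x # y) ⇔ (x < y ⊎ y < x)
    0<1                  : 0# < 1#
    +-monoʳ-<            : ∀ x {y z} → y < z → x + y < x + z
    *-pos                : ∀ {x y} → 0# < x → 0# < y → 0# < x * y

  _≤_ : Rel Carrier ℓ₂
  x ≤ y = ¬ (y < x)

  -- Exchanging j and k shows that these are conditions on absolute values.

  IsCauchy : (ℕ → Carrier) → Set (c ⊔ ℓ₂)
  IsCauchy s = ∀ ε → 0# < ε →
    ∃ λ N → ∀ j k → N ℕ.≤ j → N ℕ.≤ k → s j - s k < ε

  _ConvergesTo_ : (ℕ → Carrier) → Carrier → Set (c ⊔ ℓ₂)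
  s ConvergesTo a = ∀ ε → 0# < ε →
    ∃ λ N → ∀ k → N ℕ.≤ k → (s k - a < ε) × (a - s k < ε)

  field
    archimedean : ∀ x → ∃ λ k → x < k ×ⁿ 1#
    complete    : ∀ s → IsCauchy s → ∃ λ a → s ConvergesTo a

------------------------------------------------------------------------
-- k-element subsets of Fin m.  The index set [2n] = {1, …, 2n} is
-- represented by Fin (n + n), with i standing for i + 1.

kSubset : ℕ → ℕ → Set
kSubset k m = Σ (Subset m) λ I → ∣ I ∣ ≡ k

-- The increasing enumeration of the elements of I.

enum : ∀ {m} (I : Subset m) → Fin ∣ I ∣ → Fin m
enum (inside  ∷ I) zero    = zero
enum (inside  ∷ I) (suc i) = suc (enum I i)
enum (outside ∷ I) i       = suc (enum I i)

image : ∀ {m k} → (Fin m → Fin k) → Subset m → Subset k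
image f S = tabulate λ j → does (any? λ i → (i ∈? S) ×-dec (f i ≟ᶠ j))

nonZero-+ : ∀ n .{{_ : NonZero n}} → NonZero (n ℕ.+ n)
nonZero-+ (suc n) = _

-- Passing from 1-based to 0-based indices conjugates by the shift by 1,
-- which commutes with i ↦ i + n modulo 2n.

ρ : ∀ n .{{_ : NonZero n}} → Fin (n ℕ.+ n) → Fin (n ℕ.+ n)
ρ n i = ((toℕ i ℕ.+ n) mod (n ℕ.+ n)) {{nonZero-+ n}}

module _ (n : ℕ) .{{_ : NonZero n}} where

  private instance
    2n≢0 : NonZero (n ℕ.+ n)
    2n≢0 = nonZero-+ n

  ρ-↑ˡ : ∀ i → ρ n (i ↑ˡ n) ≡ n ↑ʳ i
  ρ-↑ˡ i = toℕ-injective (begin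
    toℕ (ρ n (i ↑ˡ n))                    ≡⟨ toℕ-fromℕ< (m%n<n (toℕ (i ↑ˡ n) ℕ.+ n) (n ℕ.+ n)) ⟩
    (toℕ (i ↑ˡ n) ℕ.+ n) % (n ℕ.+ n)      ≡⟨ cong (λ k → (k ℕ.+ n) % (n ℕ.+ n)) (toℕ-↑ˡ i n) ⟩
    (toℕ i ℕ.+ n) % (n ℕ.+ n)             ≡⟨ m<n⇒m%n≡m (ℕₚ.+-monoˡ-< n (toℕ<n i)) ⟩
    toℕ i ℕ.+ n                           ≡⟨ ℕₚ.+-comm (toℕ i) n ⟩
    n ℕ.+ toℕ i                           ≡⟨ toℕ-↑ʳ n i ⟨
    toℕ (n ↑ʳ i)                          ∎)
    where open ≡-Reasoning

  ρ-↑ʳ : ∀ i → ρ n (n ↑ʳ i) ≡ i ↑ˡ n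
  ρ-↑ʳ i = toℕ-injective (begin
    toℕ (ρ n (n ↑ʳ i))                    ≡⟨ toℕ-fromℕ< (m%n<n (toℕ (n ↑ʳ i) ℕ.+ n) (n ℕ.+ n)) ⟩
    (toℕ (n ↑ʳ i) ℕ.+ n) % (n ℕ.+ n)      ≡⟨ cong (λ k → (k ℕ.+ n) % (n ℕ.+ n)) (trans (toℕ-↑ʳ n i) (ℕₚ.+-comm n (toℕ i))) ⟩
    (toℕ i ℕ.+ n ℕ.+ n) % (n ℕ.+ n)       ≡⟨ cong (_% (n ℕ.+ n)) (ℕₚ.+-assoc (toℕ i) n n) ⟩
    (toℕ i ℕ.+ (n ℕ.+ n)) % (n ℕ.+ n)     ≡⟨ [m+n]%n≡m%n (toℕ i) (n ℕ.+ n) ⟩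
    toℕ i % (n ℕ.+ n)                     ≡⟨ m<n⇒m%n≡m (ℕₚ.<-≤-trans (toℕ<n i) (ℕₚ.m≤m+n n n)) ⟩
    toℕ i                                 ≡⟨ toℕ-↑ˡ i n ⟨
    toℕ (i ↑ˡ n)                          ∎)
    where open ≡-Reasoning

  ρ-involutive : ∀ j → ρ n (ρ n j) ≡ j
  ρ-involutive j with splitAt n j | join-splitAt n n j
  ... | inj₁ i | refl = trans (cong (ρ n) (ρ-↑ˡ i)) (ρ-↑ʳ i)
  ... | inj₂ i | refl = trans (cong (ρ n) (ρ-↑ʳ i)) (ρ-↑ˡ i)

  image-ρ : ∀ S → image (ρ n) S ≡ tabulate (lookup S ∘ ρ n)
  image-ρ S = tabulate-cong lemma
    where
    lemma : ∀ j → does (any? λ i → (i ∈? S) ×-dec (ρ n i ≟ᶠ j)) ≡ lookup S (ρ n j)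
    lemma j with any? (λ i → (i ∈? S) ×-dec (ρ n i ≟ᶠ j))
    ... | yes (i , i∈S , refl) = sym (trans (cong (lookup S) (ρ-involutive i)) ([]=⇒lookup i∈S))
    ... | no ¬∃ with lookup S (ρ n j) in eq
    ...   | inside  = contradiction (ρ n j , lookup⇒[]= (ρ n j) S eq , ρ-involutive j) ¬∃
    ...   | outside = refl

∣tabulate∣-+ : ∀ m {k} (f : Fin (m ℕ.+ k) → _) →
  ∣ tabulate f ∣ ≡ ∣ tabulate (f ∘ (_↑ˡ k)) ∣ ℕ.+ ∣ tabulate (f ∘ (m ↑ʳ_)) ∣
∣tabulate∣-+ zero    f = refl
∣tabulate∣-+ (suc m) f with f zero
... | inside  = cong suc (∣tabulate∣-+ m (f ∘ suc))
... | outside = ∣tabulate∣-+ m (f ∘ suc)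

∣image-ρ∣ : ∀ n .{{_ : NonZero n}} (S : Subset (n ℕ.+ n)) → ∣ image (ρ n) S ∣ ≡ ∣ S ∣
∣image-ρ∣ n S = begin
  ∣ image (ρ n) S ∣                            ≡⟨ cong ∣_∣ (image-ρ n S) ⟩
  ∣ tabulate (f ∘ ρ n) ∣                       ≡⟨ ∣tabulate∣-+ n (f ∘ ρ n) ⟩
  ∣ tabulate (f ∘ ρ n ∘ (_↑ˡ n)) ∣ ℕ.+ ∣ tabulate (f ∘ ρ n ∘ (n ↑ʳ_)) ∣
    ≡⟨ cong₂ ℕ._+_ (cong ∣_∣ (tabulate-cong (cong f ∘ ρ-↑ˡ n)))
                   (cong ∣_∣ (tabulate-cong (cong f ∘ ρ-↑ʳ n))) ⟩
  ∣ tabulate (f ∘ (n ↑ʳ_)) ∣ ℕ.+ ∣ tabulate (f ∘ (_↑ˡ n)) ∣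
    ≡⟨ ℕₚ.+-comm ∣ tabulate (f ∘ (n ↑ʳ_)) ∣ ∣ tabulate (f ∘ (_↑ˡ n)) ∣ ⟩
  ∣ tabulate (f ∘ (_↑ˡ n)) ∣ ℕ.+ ∣ tabulate (f ∘ (n ↑ʳ_)) ∣
    ≡⟨ ∣tabulate∣-+ n f ⟨
  ∣ tabulate f ∣                               ≡⟨ cong ∣_∣ (tabulate∘lookup S) ⟩
  ∣ S ∣                                        ∎
  where
  open ≡-Reasoning
  f : Fin (n ℕ.+ n) → _
  f = lookup S

𝓡 : ∀ {n} .{{_ : NonZero n}} → kSubset n (n ℕ.+ n) → kSubset n (n ℕ.+ n)
𝓡 {n} (I , ∣I∣≡n) = image (ρ n) (∁ I) , (begin
  ∣ image (ρ n) (∁ I) ∣   ≡⟨ ∣image-ρ∣ n (∁ I) ⟩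
  ∣ ∁ I ∣                 ≡⟨ ∣∁p∣≡n∸∣p∣ I ⟩
  n ℕ.+ n ℕ.∸ ∣ I ∣       ≡⟨ cong (n ℕ.+ n ℕ.∸_) ∣I∣≡n ⟩
  n ℕ.+ n ℕ.∸ n           ≡⟨ ℕₚ.m+n∸n≡m n n ⟩
  n                       ∎)
  where open ≡-Reasoning

------------------------------------------------------------------------

module Grassmannian {c ℓ₁ ℓ₂ : Level} (ℝ : RealNumbers c ℓ₁ ℓ₂) where

  open RealNumbers ℝ hiding (zero; refl; sym; trans)

  Matrix : ℕ → ℕ → Set c
  Matrix k m = Fin k → Vector Carrier m

  det : ∀ {k} → Matrix k k → Carrier
  det {zero}  A = 1#
  det {suc k} A = sum λ j →
    (- 1#) ^ toℕ j * (A zero j * det λ i l → A (suc i) (punchIn j l))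

  minor : ∀ {k m} → Matrix k m → kSubset k m → Carrier
  minor A (I , ∣I∣≡k) = det λ i j → A (cast ∣I∣≡k i) (enum I j)

  linearCombination : ∀ {k m} → Vector Carrier k → Matrix k m → Vector Carrier m
  linearCombination a A j = sum λ i → a i * A i j

  record Subspace (m : ℕ) : Set (lsuc (c ⊔ ℓ₁)) where
    field
      member : Pred (Vector Carrier m) (c ⊔ ℓ₁)
      resp   : ∀ {x y} → (∀ j → x j ≈ y j) → member x → member y
      zero∈  : member (λ _ → 0#)
      +∈     : ∀ {x y} → member x → member y → member (λ j → x j + y j)
      *∈     : ∀ t {x} → member x → member (λ j → t * x j)

  -- The rows of A form a basis of V.

  record Represents {k m : ℕ} (A : Matrix k m) (V : Subspace m) : Set (c ⊔ ℓ₁) where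
    open Subspace V
    field
      rows∈       : ∀ i → member (A i)
      spanning    : ∀ x → member x → ∃ λ a → ∀ j → x j ≈ linearCombination a A j
      independent : ∀ a → (∀ j → linearCombination a A j ≈ 0#) → ∀ i → a i ≈ 0#

  -- A k-dimensional subspace of ℝᵐ.  That its dimension is k is witnessed
  -- by a basis, which also fixes the scaling of the Plücker coordinates Δ.
  -- As the basis is arbitrary, quantifying over Gr k m quantifies over all
  -- pairs of a subspace and a representing matrix.

  record Gr (k m : ℕ) : Set (lsuc (c ⊔ ℓ₁)) where
    field
      subspace   : Subspace m
      matrix     : Matrix k m
      represents : Represents matrix subspace

    open Subspace subspace public

  Δ : ∀ {k m} → Gr k m → kSubset k m → Carrier
  Δ X = minor (Gr.matrix X)

  Gr≥0 : ∀ k m → Pred (Gr k m) (c ⊔ ℓ₂)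
  Gr≥0 k m X = ∃ λ t → t # 0# × (∀ I → 0# ≤ t * Δ X I)

  R : ∀ n → Vector Carrier (n ℕ.+ n) → Vector Carrier (n ℕ.+ n) → Carrier
  R n x y = sum λ (i : Fin n) →
    (- 1#) ^ toℕ i * (x (i ↑ˡ n) * y (n ↑ʳ i) - x (n ↑ʳ i) * y (i ↑ˡ n))

  LGᴿ : ∀ n → Pred (Gr n (n ℕ.+ n)) (c ⊔ ℓ₁)
  LGᴿ n X = ∀ x y → Gr.member X x → Gr.member X y → R n x y ≈ 0#

  LGᴿ≥0 : ∀ n → Pred (Gr n (n ℕ.+ n)) (c ⊔ ℓ₁ ⊔ ℓ₂)
  LGᴿ≥0 n = LGᴿ n ∩ᵖ Gr≥0 n (n ℕ.+ n)

{-# OPTIONS --safe #-}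

-- Write p for the Plücker vector x₁ ∧ … ∧ xₙ of X and H for the operator
-- (H q)(I) = q(𝓡 I).  Up to signs that do not matter, H intertwines the
-- contraction by R(x, ·) with the exterior product by x.
--
-- If X is isotropic, then contraction by R(x, ·) kills p for x ∈ X, so
-- x ∧ (H p - p) = 0 for all x ∈ X, which determines H p - p up to a scalar.
-- An isotropic X has a nonzero Plücker coordinate at some T that meets every
-- pair {j, ρ(j)} once; as 𝓡(T) = T, the scalar is zero.
--
-- Conversely, if H p = p, then contraction by R(x, ·) kills p for x ∈ X, and
-- for z ∈ X the anticommutation of this contraction with z ∧ _ reads
-- 0 = R(x, z) p, while p ≠ 0.
--
-- Pivots are only found up to double negation, which suffices because _≈_ is
-- stable by tightness of the apartness.

module Submission where

open import Defs
open import Algebra.Apartness.Bundles using (module HeytingField)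
open import Algebra.Bundles using (CommutativeRing; Semiring)
import Algebra.Definitions.RawSemiring as RawSemiringDefinitions
open import Data.Bool.Base using (if_then_else_; not)
open import Data.Bool.Properties using (not-involutive)
open import Data.Fin.Base using (Fin; zero; suc; toℕ; punchIn; cast; splitAt; _↑ˡ_; _↑ʳ_)
open import Data.Fin.Properties using (cast-is-id; splitAt-↑ˡ; splitAt-↑ʳ; join-splitAt)
  renaming (_≟_ to _≟ᶠ_)
open import Data.Fin.Subset
  using (Subset; inside; outside; ∁; ∣_∣; ⊥; _∈_; _∉_; _⊆_; _⊂_; _∩_)
open import Data.Fin.Subset.Properties
open import Data.Integer.Base as ℤ using (ℤ; +_; -[1+_]; +0; _⊖_; _◃_; sign)
import Data.Integer.Properties as ℤₚ
open import Data.Maybe.Base using (Maybe; just; nothing)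
open import Data.Nat.Base as ℕ using (ℕ; zero; suc; NonZero) renaming (_+_ to _+ℕ_)
import Data.Nat.Properties as ℕₚ
open import Data.Product.Base using (∃; _×_; _,_; proj₁; proj₂)
open import Data.Sign.Base as Sign using (Sign)
open import Data.Sum.Base using (inj₁; inj₂; [_,_]′)
open import Data.Unit.Base using (⊤; tt)
open import Data.Vec.Base as Vec using ([]; _∷_; here; lookup; tabulate; _[_]≔_; _++_)
open import Data.Vec.Functional using (Vector)
open import Data.Vec.Properties
  using (lookup∘update; lookup∘update′; lookup-replicate; []=⇒lookup; lookup⇒[]=; lookup-map;
         lookup∘tabulate; lookup-++ˡ; lookup-++ʳ; tabulate-cong; tabulate∘lookup)
open import Function.Base using (_∘_; const)
open import Level using (Level; _⊔_)
open import Relation.Binary.PropositionalEquality as ≡ using (_≡_; _≢_)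
open import Relation.Binary.Structures using (IsStrictPartialOrder)
open import Relation.Nullary using (¬_; yes; no; contradiction)
open import Relation.Unary using (_≐_)

-- The ring solver with integer coefficients

-- The alternating signs in R come from complementation: inside one half of the index set, passing
-- to the complement turns the exterior product by x into the contraction by the covector with
-- entries (-1)^i x_i. The minus sign between the two products in R matches the sign of passing
-- across a half. Exterior product and contraction are two cases of one recursive operator, so that
-- anticommutation and the effect of complements are each proved once. Coefficients are indexed by
-- all subsets, which keeps this recursion free of cardinality proofs; degrees enter as conditions
-- on `∣ I ∣` in the sign comparison and in the exchange argument.
--
-- That H p - p is determined up to a scalar is such an exchange argument: with reduced rows, x ∧ D
-- = 0 expresses D at S through subsets closer to the pivot set T. The transversal T comes from an
-- elimination that admits a column only while its partner under ρ is not a pivot; isotropy ensures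
-- that this restriction never blocks the search.

module IntegerSolver {c ℓ} (R : CommutativeRing c ℓ) where

  open CommutativeRing R hiding (zero)
  open import Algebra.Properties.AbelianGroup +-abelianGroup using (⁻¹-∙-comm)
  open import Algebra.Properties.CommutativeSemigroup *-commutativeSemigroup using (interchange)
  open import Algebra.Properties.Group +-group using (⁻¹-involutive; ε⁻¹≈ε)
  open import Algebra.Properties.Ring ring using (-1*x≈-x)
  open import Algebra.Properties.Semiring.Mult.TCOptimised semiring
    using (1+×; ×-homo-+; ×1-homo-*) renaming (_×_ to _×ⁿ_)
  open import Algebra.Solver.Ring.AlmostCommutativeRing
    using (fromCommutativeRing; _-Raw-AlmostCommutative⟶_)
  open import Relation.Binary.Reasoning.Setoid setoid

  -- Integer coefficients have decidable equality, which lets the normaliser see cancellations;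
  -- equality in the ring is not assumed decidable. The optimised multiple makes `⟦ + 1 ⟧` compute
  -- to `1#`, so `con (+ 1)` stands for it definitionally.
  ⟦_⟧ : ℤ → Carrier
  ⟦ + n ⟧      = n ×ⁿ 1#
  ⟦ -[1+ n ] ⟧ = - (suc n ×ⁿ 1#)

  cancel-1+ : ∀ a b → (1# + a) - (1# + b) ≈ a - b
  cancel-1+ a b = begin
    (1# + a) + - (1# + b)   ≈⟨ +-cong (+-comm 1# a) (sym (⁻¹-∙-comm 1# b)) ⟩
    (a + 1#) + (- 1# - b)   ≈⟨ +-assoc a 1# (- 1# - b) ⟩
    a + (1# + (- 1# - b))   ≈⟨ +-congˡ (+-assoc 1# (- 1#) (- b)) ⟨
    a + ((1# - 1#) - b)     ≈⟨ +-congˡ (+-congʳ (-‿inverseʳ 1#)) ⟩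
    a + (0# - b)            ≈⟨ +-congˡ (+-identityˡ (- b)) ⟩
    a - b                   ∎

  ⟦⊖⟧ : ∀ m n → ⟦ m ⊖ n ⟧ ≈ m ×ⁿ 1# - n ×ⁿ 1#
  ⟦⊖⟧ zero    zero    = sym (-‿inverseʳ 0#)
  ⟦⊖⟧ zero    (suc n) = sym (+-identityˡ _)
  ⟦⊖⟧ (suc m) zero    = sym (trans (+-congˡ ε⁻¹≈ε) (+-identityʳ _))
  ⟦⊖⟧ (suc m) (suc n) = begin
    ⟦ suc m ⊖ suc n ⟧                ≡⟨ ≡.cong ⟦_⟧ (ℤₚ.[1+m]⊖[1+n]≡m⊖n m n) ⟩
    ⟦ m ⊖ n ⟧                        ≈⟨ ⟦⊖⟧ m n ⟩
    m ×ⁿ 1# - n ×ⁿ 1#                  ≈⟨ cancel-1+ (m ×ⁿ 1#) (n ×ⁿ 1#) ⟨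
    (1# + m ×ⁿ 1#) - (1# + n ×ⁿ 1#)    ≈⟨ +-cong (1+× m 1#) (-‿cong (1+× n 1#)) ⟨
    suc m ×ⁿ 1# - suc n ×ⁿ 1#          ∎

  ⟦-⟧ : ∀ i → ⟦ ℤ.- i ⟧ ≈ - ⟦ i ⟧
  ⟦-⟧ (+ zero)  = sym ε⁻¹≈ε
  ⟦-⟧ (+ suc n) = refl
  ⟦-⟧ -[1+ n ]  = sym (⁻¹-involutive _)

  ⟦+⟧ : ∀ i j → ⟦ i ℤ.+ j ⟧ ≈ ⟦ i ⟧ + ⟦ j ⟧
  ⟦+⟧ (+ m)    (+ n)    = ×-homo-+ 1# m n
  ⟦+⟧ (+ m)    -[1+ n ] = ⟦⊖⟧ m (suc n)
  ⟦+⟧ -[1+ m ] (+ n)    = trans (⟦⊖⟧ n (suc m)) (+-comm _ _)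
  ⟦+⟧ -[1+ m ] -[1+ n ] = begin
    - (suc (suc (m ℕ.+ n)) ×ⁿ 1#)     ≡⟨ ≡.cong (λ k → - (suc k ×ⁿ 1#)) (ℕₚ.+-suc m n) ⟨
    - ((suc m ℕ.+ suc n) ×ⁿ 1#)       ≈⟨ -‿cong (×-homo-+ 1# (suc m) (suc n)) ⟩
    - (suc m ×ⁿ 1# + suc n ×ⁿ 1#)      ≈⟨ ⁻¹-∙-comm _ _ ⟨
    - (suc m ×ⁿ 1#) - suc n ×ⁿ 1#      ∎

  ⟦_⟧ₛ : Sign → Carrier
  ⟦ Sign.+ ⟧ₛ = 1#
  ⟦ Sign.- ⟧ₛ = - 1#

  ⟦◃⟧ : ∀ s n → ⟦ s ◃ n ⟧ ≈ ⟦ s ⟧ₛ * (n ×ⁿ 1#)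
  ⟦◃⟧ s      zero    = sym (zeroʳ _)
  ⟦◃⟧ Sign.+ (suc n) = sym (*-identityˡ _)
  ⟦◃⟧ Sign.- (suc n) = sym (-1*x≈-x _)

  ⟦*⟧ₛ : ∀ s t → ⟦ s Sign.* t ⟧ₛ ≈ ⟦ s ⟧ₛ * ⟦ t ⟧ₛ
  ⟦*⟧ₛ Sign.+ t      = sym (*-identityˡ _)
  ⟦*⟧ₛ Sign.- Sign.+ = sym (*-identityʳ _)
  ⟦*⟧ₛ Sign.- Sign.- = sym (trans (-1*x≈-x _) (⁻¹-involutive _))

  ⟦*⟧ : ∀ i j → ⟦ i ℤ.* j ⟧ ≈ ⟦ i ⟧ * ⟦ j ⟧
  ⟦*⟧ i j = begin
    ⟦ i ℤ.* j ⟧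
      ≈⟨ ⟦◃⟧ (sign i Sign.* sign j) (ℤ.∣ i ∣ ℕ.* ℤ.∣ j ∣) ⟩
    ⟦ sign i Sign.* sign j ⟧ₛ * ((ℤ.∣ i ∣ ℕ.* ℤ.∣ j ∣) ×ⁿ 1#)
      ≈⟨ *-cong (⟦*⟧ₛ (sign i) (sign j)) (×1-homo-* ℤ.∣ i ∣ ℤ.∣ j ∣) ⟩
    (⟦ sign i ⟧ₛ * ⟦ sign j ⟧ₛ) * ((ℤ.∣ i ∣ ×ⁿ 1#) * (ℤ.∣ j ∣ ×ⁿ 1#))
      ≈⟨ interchange _ _ _ _ ⟩
    (⟦ sign i ⟧ₛ * (ℤ.∣ i ∣ ×ⁿ 1#)) * (⟦ sign j ⟧ₛ * (ℤ.∣ j ∣ ×ⁿ 1#))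
      ≈⟨ *-cong (⟦◃⟧ (sign i) ℤ.∣ i ∣) (⟦◃⟧ (sign j) ℤ.∣ j ∣) ⟨
    ⟦ sign i ◃ ℤ.∣ i ∣ ⟧ * ⟦ sign j ◃ ℤ.∣ j ∣ ⟧
      ≡⟨ ≡.cong₂ (λ a b → ⟦ a ⟧ * ⟦ b ⟧) (ℤₚ.◃-inverse i) (ℤₚ.◃-inverse j) ⟩
    ⟦ i ⟧ * ⟦ j ⟧  ∎

  homomorphism : ℤ.+-*-rawRing -Raw-AlmostCommutative⟶ fromCommutativeRing R
  homomorphism = record
    { ⟦_⟧    = ⟦_⟧
    ; +-homo = ⟦+⟧
    ; *-homo = ⟦*⟧
    ; -‿homo = ⟦-⟧
    ; 0-homo = refl
    ; 1-homo = refl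
    }

  _≟_ : ∀ i j → Maybe (⟦ i ⟧ ≈ ⟦ j ⟧)
  i ≟ j with i ℤₚ.≟ j
  ... | yes i≡j = just (reflexive (≡.cong ⟦_⟧ i≡j))
  ... | no  _   = nothing

  open import Algebra.Solver.Ring ℤ.+-*-rawRing (fromCommutativeRing R) homomorphism _≟_ public
    using (solve; _:=_; _:+_; _:*_; _:-_; :-_; con)

-- Clifford operators on the exterior algebra

module Clifford {c ℓ} (R : CommutativeRing c ℓ) where

  open CommutativeRing R hiding (zero)
  open RawSemiringDefinitions (Semiring.rawSemiring semiring) using (sum; _^_)
  open import Algebra.Properties.Semiring.Sum semiring
    using (sum-cong-≋; sum-replicate-zero; ∑-distrib-+; *-distribˡ-sum)
  open import Relation.Binary.Reasoning.Setoid setoid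
  open IntegerSolver R using (solve; _:=_; _:+_; _:*_; _:-_; :-_; con)

  private variable
    k m n : ℕ

  sum-zero : ∀ (f : Vector Carrier n) → (∀ i → f i ≈ 0#) → sum f ≈ 0#
  sum-zero {n} f f≈0 = trans (sum-cong-≋ f≈0) (sum-replicate-zero n)

  sum-single : ∀ (f : Vector Carrier n) i → (∀ j → j ≢ i → f j ≈ 0#) → sum f ≈ f i
  sum-single f zero    h = trans (+-congˡ (sum-zero (f ∘ suc) λ j → h (suc j) λ ())) (+-identityʳ _)
  sum-single f (suc i) h = trans
    (+-cong (h zero λ ()) (sum-single (f ∘ suc) i λ j j≢i → h (suc j) λ { ≡.refl → j≢i ≡.refl }))
    (+-identityˡ _)

  sum-↑ : ∀ a {b} (f : Vector Carrier (a ℕ.+ b)) →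
    sum f ≈ sum (f ∘ (_↑ˡ b)) + sum (f ∘ (a ↑ʳ_))
  sum-↑ zero    f = sym (+-identityˡ _)
  sum-↑ (suc a) f = trans (+-congˡ (sum-↑ a (f ∘ suc))) (sym (+-assoc _ _ _))

  Form : ℕ → Set c
  Form m = Subset m → Carrier

  -- x ∧ P plus the contraction of P by φ, where P I is the coefficient of the
  -- basis multivector indexed by I.
  clifford : Vector Carrier m → Vector Carrier m → Form m → Form m
  clifford x φ P []            = 0#
  clifford x φ P (inside  ∷ I) =
    x zero * P (outside ∷ I) - clifford (x ∘ suc) (φ ∘ suc) (P ∘ (inside ∷_)) I
  clifford x φ P (outside ∷ I) =
    φ zero * P (inside ∷ I) + clifford (x ∘ suc) (φ ∘ suc) (P ∘ (outside ∷_)) I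

  wedge : Vector Carrier m → Form m → Form m
  wedge x = clifford x (const 0#)

  contract : Vector Carrier m → Form m → Form m
  contract = clifford (const 0#)

  pairing : Vector Carrier m → Vector Carrier m → Carrier
  pairing φ x = sum λ j → φ j * x j

  clifford-cong : ∀ {x x′ φ φ′ : Vector Carrier m} {P Q : Form m} →
    (∀ j → x j ≈ x′ j) → (∀ j → φ j ≈ φ′ j) → (∀ I → P I ≈ Q I) →
    ∀ I → clifford x φ P I ≈ clifford x′ φ′ Q I
  clifford-cong x≈ φ≈ P≈ []            = refl
  clifford-cong x≈ φ≈ P≈ (inside  ∷ I) =
    +-cong (*-cong (x≈ zero) (P≈ _)) (-‿cong (clifford-cong (x≈ ∘ suc) (φ≈ ∘ suc) (P≈ ∘ _) I))
  clifford-cong x≈ φ≈ P≈ (outside ∷ I) =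
    +-cong (*-cong (φ≈ zero) (P≈ _)) (clifford-cong (x≈ ∘ suc) (φ≈ ∘ suc) (P≈ ∘ _) I)

  -- Composing two operators and unfolding the inner one at the first index leaves an argument of
  -- this shape, or of that in `clifford-axmy`.
  clifford-axpy : ∀ (x φ : Vector Carrier m) a (P Q : Form m) I →
    clifford x φ (λ J → a * P J + Q J) I ≈ a * clifford x φ P I + clifford x φ Q I
  clifford-axpy x φ a P Q []            = solve 1 (λ a → con +0 := a :* con +0 :+ con +0) refl a
  clifford-axpy x φ a P Q (inside  ∷ I) = trans
    (+-congˡ (-‿cong (clifford-axpy (x ∘ suc) (φ ∘ suc) a (P ∘ (inside ∷_)) (Q ∘ (inside ∷_)) I)))
    (solve 6 (λ x a p q r s →
       x :* (a :* p :+ q) :- (a :* r :+ s) := a :* (x :* p :- r) :+ (x :* q :- s)) refl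
       (x zero) a (P (outside ∷ I)) (Q (outside ∷ I)) _ _)
  clifford-axpy x φ a P Q (outside ∷ I) = trans
    (+-congˡ (clifford-axpy (x ∘ suc) (φ ∘ suc) a (P ∘ (outside ∷_)) (Q ∘ (outside ∷_)) I))
    (solve 6 (λ x a p q r s →
       x :* (a :* p :+ q) :+ (a :* r :+ s) := a :* (x :* p :+ r) :+ (x :* q :+ s)) refl
       (φ zero) a (P (inside ∷ I)) (Q (inside ∷ I)) _ _)

  clifford-neg : ∀ (x φ : Vector Carrier m) (P : Form m) I →
    clifford x φ (λ J → - P J) I ≈ - clifford x φ P I
  clifford-neg x φ P []            = solve 0 (con +0 := :- con +0) refl
  clifford-neg x φ P (inside  ∷ I) = trans
    (+-congˡ (-‿cong (clifford-neg (x ∘ suc) (φ ∘ suc) (P ∘ (inside ∷_)) I)))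
    (solve 3 (λ x p q → x :* (:- p) :- (:- q) := :- (x :* p :- q)) refl (x zero) (P (outside ∷ I)) _)
  clifford-neg x φ P (outside ∷ I) = trans
    (+-congˡ (clifford-neg (x ∘ suc) (φ ∘ suc) (P ∘ (outside ∷_)) I))
    (solve 3 (λ x p q → x :* (:- p) :+ (:- q) := :- (x :* p :+ q)) refl (φ zero) (P (inside ∷ I)) _)

  clifford-axmy : ∀ (x φ : Vector Carrier m) a (P Q : Form m) I →
    clifford x φ (λ J → a * P J - Q J) I ≈ a * clifford x φ P I - clifford x φ Q I
  clifford-axmy x φ a P Q I = trans
    (clifford-axpy x φ a P (λ J → - Q J) I)
    (+-congˡ (clifford-neg x φ Q I))

  clifford-negᵥ : ∀ (x φ : Vector Carrier m) (P : Form m) I →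
    clifford (λ j → - x j) (λ j → - φ j) P I ≈ - clifford x φ P I
  clifford-negᵥ x φ P []            = solve 0 (con +0 := :- con +0) refl
  clifford-negᵥ x φ P (inside  ∷ I) = trans
    (+-congˡ (-‿cong (clifford-negᵥ (x ∘ suc) (φ ∘ suc) (P ∘ (inside ∷_)) I)))
    (solve 3 (λ x p q → (:- x) :* p :- (:- q) := :- (x :* p :- q)) refl (x zero) (P (outside ∷ I)) _)
  clifford-negᵥ x φ P (outside ∷ I) = trans
    (+-congˡ (clifford-negᵥ (x ∘ suc) (φ ∘ suc) (P ∘ (outside ∷_)) I))
    (solve 3 (λ x p q → (:- x) :* p :+ (:- q) := :- (x :* p :+ q)) refl (φ zero) (P (inside ∷ I)) _)

  wedge-axpyᵥ : ∀ a (x y : Vector Carrier m) (P : Form m) I →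
    wedge (λ j → a * x j + y j) P I ≈ a * wedge x P I + wedge y P I
  wedge-axpyᵥ a x y P []            = solve 1 (λ a → con +0 := a :* con +0 :+ con +0) refl a
  wedge-axpyᵥ a x y P (inside  ∷ I) = trans
    (+-congˡ (-‿cong (wedge-axpyᵥ a (x ∘ suc) (y ∘ suc) (P ∘ (inside ∷_)) I)))
    (solve 6 (λ a x y p r s →
       (a :* x :+ y) :* p :- (a :* r :+ s) := a :* (x :* p :- r) :+ (y :* p :- s)) refl
       a (x zero) (y zero) (P (outside ∷ I)) _ _)
  wedge-axpyᵥ a x y P (outside ∷ I) = trans
    (+-congˡ (wedge-axpyᵥ a (x ∘ suc) (y ∘ suc) (P ∘ (outside ∷_)) I))
    (solve 4 (λ a p r s →
       con +0 :* p :+ (a :* r :+ s) := a :* (con +0 :* p :+ r) :+ (con +0 :* p :+ s)) refl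
       a (P (inside ∷ I)) _ _)

  -- The Clifford relation for the canonical pairing of covectors and vectors. At the first index
  -- the mixed terms `a` and `b` cancel because the `inside` clause carries a minus sign; the
  -- contribution of that index and the relation for the tails remain.
  clifford-anticomm : ∀ (x φ y ψ : Vector Carrier m) (P : Form m) I →
    clifford x φ (clifford y ψ P) I + clifford y ψ (clifford x φ P) I
      ≈ (pairing φ y + pairing ψ x) * P I
  clifford-anticomm x φ y ψ P []            =
    solve 1 (λ p → con +0 :+ con +0 := (con +0 :+ con +0) :* p) refl (P [])
  clifford-anticomm x φ y ψ P (inside  ∷ I) = begin
    (x₀ * (ψ₀ * p + b) - clifford x′ φ′ (λ J → y₀ * Pₒ J - clifford y′ ψ′ Pᵢ J) I) +
    (y₀ * (φ₀ * p + a) - clifford y′ ψ′ (λ J → x₀ * Pₒ J - clifford x′ φ′ Pᵢ J) I)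
      ≈⟨ +-cong (+-congˡ (-‿cong (clifford-axmy x′ φ′ y₀ Pₒ (clifford y′ ψ′ Pᵢ) I)))
                (+-congˡ (-‿cong (clifford-axmy y′ ψ′ x₀ Pₒ (clifford x′ φ′ Pᵢ) I))) ⟩
    (x₀ * (ψ₀ * p + b) - (y₀ * a - ab)) + (y₀ * (φ₀ * p + a) - (x₀ * b - ba))
      ≈⟨ solve 9 (λ x ψ p b y a ab φ ba →
           (x :* (ψ :* p :+ b) :- (y :* a :- ab)) :+ (y :* (φ :* p :+ a) :- (x :* b :- ba))
             := (φ :* y :+ ψ :* x) :* p :+ (ab :+ ba)) refl x₀ ψ₀ p b y₀ a ab φ₀ ba ⟩
    (φ₀ * y₀ + ψ₀ * x₀) * p + (ab + ba)
      ≈⟨ +-congˡ (clifford-anticomm x′ φ′ y′ ψ′ Pᵢ I) ⟩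
    (φ₀ * y₀ + ψ₀ * x₀) * p + (pairing φ′ y′ + pairing ψ′ x′) * p
      ≈⟨ solve 5 (λ u v p s t → (u :+ v) :* p :+ (s :+ t) :* p := ((u :+ s) :+ (v :+ t)) :* p) refl
           (φ₀ * y₀) (ψ₀ * x₀) p (pairing φ′ y′) (pairing ψ′ x′) ⟩
    (pairing φ y + pairing ψ x) * p  ∎
    where
    x′ = x ∘ suc ; φ′ = φ ∘ suc ; y′ = y ∘ suc ; ψ′ = ψ ∘ suc
    x₀ = x zero ; φ₀ = φ zero ; y₀ = y zero ; ψ₀ = ψ zero
    Pᵢ = P ∘ (inside ∷_) ; Pₒ = P ∘ (outside ∷_)
    p = Pᵢ I
    a = clifford x′ φ′ Pₒ I ; b = clifford y′ ψ′ Pₒ I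
    ab = clifford x′ φ′ (clifford y′ ψ′ Pᵢ) I ; ba = clifford y′ ψ′ (clifford x′ φ′ Pᵢ) I
  clifford-anticomm x φ y ψ P (outside ∷ I) = begin
    (φ₀ * (y₀ * p - b) + clifford x′ φ′ (λ J → ψ₀ * Pᵢ J + clifford y′ ψ′ Pₒ J) I) +
    (ψ₀ * (x₀ * p - a) + clifford y′ ψ′ (λ J → φ₀ * Pᵢ J + clifford x′ φ′ Pₒ J) I)
      ≈⟨ +-cong (+-congˡ (clifford-axpy x′ φ′ ψ₀ Pᵢ (clifford y′ ψ′ Pₒ) I))
                (+-congˡ (clifford-axpy y′ ψ′ φ₀ Pᵢ (clifford x′ φ′ Pₒ) I)) ⟩
    (φ₀ * (y₀ * p - b) + (ψ₀ * a + ab)) + (ψ₀ * (x₀ * p - a) + (φ₀ * b + ba))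
      ≈⟨ solve 9 (λ x ψ p b y a ab φ ba →
           (φ :* (y :* p :- b) :+ (ψ :* a :+ ab)) :+ (ψ :* (x :* p :- a) :+ (φ :* b :+ ba))
             := (φ :* y :+ ψ :* x) :* p :+ (ab :+ ba)) refl x₀ ψ₀ p b y₀ a ab φ₀ ba ⟩
    (φ₀ * y₀ + ψ₀ * x₀) * p + (ab + ba)
      ≈⟨ +-congˡ (clifford-anticomm x′ φ′ y′ ψ′ Pₒ I) ⟩
    (φ₀ * y₀ + ψ₀ * x₀) * p + (pairing φ′ y′ + pairing ψ′ x′) * p
      ≈⟨ solve 5 (λ u v p s t → (u :+ v) :* p :+ (s :+ t) :* p := ((u :+ s) :+ (v :+ t)) :* p) refl
           (φ₀ * y₀) (ψ₀ * x₀) p (pairing φ′ y′) (pairing ψ′ x′) ⟩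
    (pairing φ y + pairing ψ x) * p  ∎
    where
    x′ = x ∘ suc ; φ′ = φ ∘ suc ; y′ = y ∘ suc ; ψ′ = ψ ∘ suc
    x₀ = x zero ; φ₀ = φ zero ; y₀ = y zero ; ψ₀ = ψ zero
    Pᵢ = P ∘ (inside ∷_) ; Pₒ = P ∘ (outside ∷_)
    p = Pₒ I
    a = clifford x′ φ′ Pᵢ I ; b = clifford y′ ψ′ Pᵢ I
    ab = clifford x′ φ′ (clifford y′ ψ′ Pₒ) I ; ba = clifford y′ ψ′ (clifford x′ φ′ Pₒ) I

  -- Anticommutation with equal factors yields only twice the square, so it is computed directly,
  -- without dividing by 2.
  wedge² : ∀ (x : Vector Carrier m) (P : Form m) I → wedge x (wedge x P) I ≈ 0#
  wedge² x P []            = refl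
  wedge² x P (inside  ∷ I) = begin
    x₀ * (0# * p + a) - wedge x′ (λ J → x₀ * P (outside ∷ J) - wedge x′ Pᵢ J) I
      ≈⟨ +-congˡ (-‿cong (clifford-axmy x′ _ x₀ (P ∘ (outside ∷_)) (wedge x′ Pᵢ) I)) ⟩
    x₀ * (0# * p + a) - (x₀ * a - aa)
      ≈⟨ solve 4 (λ x p a aa → x :* (con +0 :* p :+ a) :- (x :* a :- aa) := aa) refl x₀ p a aa ⟩
    aa
      ≈⟨ wedge² x′ Pᵢ I ⟩
    0#  ∎
    where
    x′ = x ∘ suc ; x₀ = x zero ; Pᵢ = P ∘ (inside ∷_)
    p = Pᵢ I ; a = wedge x′ (P ∘ (outside ∷_)) I ; aa = wedge x′ (wedge x′ Pᵢ) I
  wedge² x P (outside ∷ I) = begin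
    0# * q + wedge x′ (λ J → 0# * P (inside ∷ J) + wedge x′ Pₒ J) I
      ≈⟨ +-congˡ (clifford-axpy x′ _ 0# (P ∘ (inside ∷_)) (wedge x′ Pₒ) I) ⟩
    0# * q + (0# * a + aa)
      ≈⟨ solve 3 (λ q a aa → con +0 :* q :+ (con +0 :* a :+ aa) := aa) refl q a aa ⟩
    aa
      ≈⟨ wedge² x′ Pₒ I ⟩
    0#  ∎
    where
    x′ = x ∘ suc ; Pₒ = P ∘ (outside ∷_)
    q = wedge x P (inside ∷ I) ; a = wedge x′ (P ∘ (inside ∷_)) I ; aa = wedge x′ (wedge x′ Pₒ) I

  -- The coefficient at `I` is a signed sum of exactly these products, one for each element of `I`.
  wedge-vanish : ∀ (x : Vector Carrier m) (P : Form m) I →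
    (∀ j → lookup I j ≡ inside → x j * P (I [ j ]≔ outside) ≈ 0#) → wedge x P I ≈ 0#
  wedge-vanish x P []            h = refl
  wedge-vanish x P (inside  ∷ I) h = trans
    (+-cong (h zero ≡.refl) (-‿cong (wedge-vanish (x ∘ suc) (P ∘ (inside ∷_)) I (h ∘ suc))))
    (solve 0 (con +0 :- con +0 := con +0) refl)
  wedge-vanish x P (outside ∷ I) h = trans
    (+-congˡ (wedge-vanish (x ∘ suc) (P ∘ (outside ∷_)) I (h ∘ suc)))
    (solve 1 (λ p → con +0 :* p :+ con +0 := con +0) refl _)

  -- -1 to the power of the number of elements of the subset below the given index.
  positionSign : Subset m → Fin m → Carrier
  positionSign (b       ∷ S) zero    = 1#
  positionSign (inside  ∷ S) (suc t) = - positionSign S t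
  positionSign (outside ∷ S) (suc t) = positionSign S t

  positionSign² : ∀ (S : Subset m) t → positionSign S t * positionSign S t ≈ 1#
  positionSign² (b       ∷ S) zero    = *-identityˡ 1#
  positionSign² (inside  ∷ S) (suc t) =
    trans (solve 1 (λ s → (:- s) :* (:- s) := s :* s) refl _) (positionSign² S t)
  positionSign² (outside ∷ S) (suc t) = positionSign² S t

  -- Of the signed sum over the enlarged set only the term that deletes `t` survives.
  wedge-insert : ∀ (x : Vector Carrier m) (P : Form m) S t → lookup S t ≡ outside →
    (∀ j → lookup S j ≡ inside → x j * P ((S [ t ]≔ inside) [ j ]≔ outside) ≈ 0#) →
    wedge x P (S [ t ]≔ inside) ≈ positionSign S t * (x t * P S)
  wedge-insert x P (outside ∷ S) zero    t∉S h = begin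
    x zero * P (outside ∷ S) - wedge (x ∘ suc) (P ∘ (inside ∷_)) S
      ≈⟨ +-congˡ (-‿cong (wedge-vanish (x ∘ suc) (P ∘ (inside ∷_)) S (h ∘ suc))) ⟩
    x zero * P (outside ∷ S) - 0#
      ≈⟨ solve 1 (λ a → a :- con +0 := con (+ 1) :* a) refl _ ⟩
    1# * (x zero * P (outside ∷ S))  ∎
  wedge-insert x P (inside  ∷ S) (suc t) t∉S h = begin
    x zero * P (outside ∷ (S [ t ]≔ inside)) - wedge (x ∘ suc) (P ∘ (inside ∷_)) (S [ t ]≔ inside)
      ≈⟨ +-cong (h zero ≡.refl)
           (-‿cong (wedge-insert (x ∘ suc) (P ∘ (inside ∷_)) S t t∉S (h ∘ suc))) ⟩
    0# - positionSign S t * (x (suc t) * P (inside ∷ S))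
      ≈⟨ solve 2 (λ s a → con +0 :- s :* a := (:- s) :* a) refl _ _ ⟩
    - positionSign S t * (x (suc t) * P (inside ∷ S))  ∎
  wedge-insert x P (outside ∷ S) (suc t) t∉S h = begin
    0# * P (inside ∷ (S [ t ]≔ inside)) + wedge (x ∘ suc) (P ∘ (outside ∷_)) (S [ t ]≔ inside)
      ≈⟨ +-congˡ (wedge-insert (x ∘ suc) (P ∘ (outside ∷_)) S t t∉S (h ∘ suc)) ⟩
    0# * P (inside ∷ (S [ t ]≔ inside)) + positionSign S t * (x (suc t) * P (outside ∷ S))
      ≈⟨ solve 2 (λ p a → con +0 :* p :+ a := a) refl _ _ ⟩
    positionSign S t * (x (suc t) * P (outside ∷ S))  ∎

  -- Splitting and complementing the index set

  paritySign : Subset m → Carrier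
  paritySign []            = 1#
  paritySign (inside  ∷ S) = - paritySign S
  paritySign (outside ∷ S) = paritySign S

  paritySign≈^ : ∀ (S : Subset m) → paritySign S ≈ (- 1#) ^ ∣ S ∣
  paritySign≈^ []            = refl
  paritySign≈^ (inside  ∷ S) = trans (-‿cong (paritySign≈^ S))
    (solve 1 (λ s → :- s := (:- con (+ 1)) :* s) refl _)
  paritySign≈^ (outside ∷ S) = paritySign≈^ S

  paritySign² : ∀ (S : Subset m) → paritySign S * paritySign S ≈ 1#
  paritySign² []            = *-identityˡ 1#
  paritySign² (inside  ∷ S) =
    trans (solve 1 (λ s → (:- s) :* (:- s) := s :* s) refl _) (paritySign² S)
  paritySign² (outside ∷ S) = paritySign² S

  -- An index in the second block is preceded by all of `S`, whence the extra sign.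
  clifford-++ : ∀ {a b} (x φ : Vector Carrier (a ℕ.+ b)) (P : Form (a ℕ.+ b))
    (S : Subset a) (S′ : Subset b) →
    clifford x φ P (S ++ S′) ≈
      clifford (x ∘ (_↑ˡ b)) (φ ∘ (_↑ˡ b)) (λ U → P (U ++ S′)) S +
      paritySign S * clifford (x ∘ (a ↑ʳ_)) (φ ∘ (a ↑ʳ_)) (λ U → P (S ++ U)) S′
  clifford-++ x φ P []            S′ = solve 1 (λ a → a := con +0 :+ con (+ 1) :* a) refl _
  clifford-++ x φ P (inside  ∷ S) S′ = trans
    (+-congˡ (-‿cong (clifford-++ (x ∘ suc) (φ ∘ suc) (P ∘ (inside ∷_)) S S′)))
    (solve 4 (λ a b s c → a :- (b :+ s :* c) := (a :- b) :+ (:- s) :* c) refl _ _ _ _)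
  clifford-++ x φ P (outside ∷ S) S′ = trans
    (+-congˡ (clifford-++ (x ∘ suc) (φ ∘ suc) (P ∘ (outside ∷_)) S S′))
    (sym (+-assoc _ _ _))

  alternate : Vector Carrier m → Vector Carrier m
  alternate x i = (- 1#) ^ toℕ i * x i

  alternate-suc : ∀ (x : Vector Carrier (suc m)) i → alternate x (suc i) ≈ - alternate (x ∘ suc) i
  alternate-suc x i = solve 2 (λ s a → ((:- con (+ 1)) :* s) :* a := :- (s :* a)) refl _ _

  -- An element a ∉ S precedes a − #(S < a) elements of the complement,
  -- which is why only the sign (-1)ᵃ of the vector changes.
  clifford-∁ : ∀ (x φ : Vector Carrier m) (Q : Form m) S →
    clifford x φ (Q ∘ ∁) S ≈ clifford (alternate φ) (alternate x) Q (∁ S)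
  clifford-∁ x φ Q []            = refl
  clifford-∁ x φ Q (inside  ∷ S) = begin
    x zero * q - clifford x′ φ′ (Q′ ∘ ∁) S
      ≈⟨ +-congˡ (-‿cong (clifford-∁ x′ φ′ Q′ S)) ⟩
    x zero * q - clifford (alternate φ′) (alternate x′) Q′ (∁ S)
      -- Shifting the index by one negates both alternating vectors. This absorbs the minus sign:
      -- the complement has turned `inside` into `outside`, whose clause has a plus.
      ≈⟨ +-cong (*-congʳ (sym (*-identityˡ _))) (sym (clifford-negᵥ _ _ Q′ (∁ S))) ⟩
    (1# * x zero) * q + clifford (λ j → - alternate φ′ j) (λ j → - alternate x′ j) Q′ (∁ S)
      ≈⟨ +-congˡ (clifford-cong (alternate-suc φ) (alternate-suc x) (λ _ → refl) (∁ S)) ⟨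
    (1# * x zero) * q + clifford (alternate φ ∘ suc) (alternate x ∘ suc) Q′ (∁ S)  ∎
    where
    x′ = x ∘ suc ; φ′ = φ ∘ suc ; Q′ = Q ∘ (outside ∷_) ; q = Q (inside ∷ ∁ S)
  clifford-∁ x φ Q (outside ∷ S) = begin
    φ zero * q + clifford x′ φ′ (Q′ ∘ ∁) S
      ≈⟨ +-cong (*-congʳ (sym (*-identityˡ _))) (clifford-∁ x′ φ′ Q′ S) ⟩
    (1# * φ zero) * q + clifford (alternate φ′) (alternate x′) Q′ (∁ S)
      ≈⟨ +-congˡ (solve 1 (λ a → a := :- (:- a)) refl _) ⟩
    (1# * φ zero) * q - (- clifford (alternate φ′) (alternate x′) Q′ (∁ S))
      ≈⟨ +-congˡ (-‿cong (clifford-negᵥ _ _ Q′ (∁ S))) ⟨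
    (1# * φ zero) * q - clifford (λ j → - alternate φ′ j) (λ j → - alternate x′ j) Q′ (∁ S)
      ≈⟨ +-congˡ (-‿cong (clifford-cong (alternate-suc φ) (alternate-suc x) (λ _ → refl) (∁ S))) ⟨
    (1# * φ zero) * q - clifford (alternate φ ∘ suc) (alternate x ∘ suc) Q′ (∁ S)  ∎
    where
    x′ = x ∘ suc ; φ′ = φ ∘ suc ; Q′ = Q ∘ (inside ∷_) ; q = Q (outside ∷ ∁ S)

  -- The multivector 1 of degree zero, from which iterated exterior products start.
  vacuum : Form m
  vacuum []            = 1#
  vacuum (inside  ∷ I) = 0#
  vacuum (outside ∷ I) = vacuum I

  contract-zero : ∀ (φ : Vector Carrier m) I → contract φ (λ _ → 0#) I ≈ 0#
  contract-zero φ []            = refl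
  contract-zero φ (inside  ∷ I) = trans
    (+-congˡ (-‿cong (contract-zero (φ ∘ suc) I)))
    (solve 0 (con +0 :* con +0 :- con +0 := con +0) refl)
  contract-zero φ (outside ∷ I) = trans
    (+-congˡ (contract-zero (φ ∘ suc) I))
    (solve 1 (λ a → a :* con +0 :+ con +0 := con +0) refl _)

  contract-vacuum : ∀ (φ : Vector Carrier m) I → contract φ vacuum I ≈ 0#
  contract-vacuum φ []            = refl
  contract-vacuum φ (inside  ∷ I) = trans
    (+-congˡ (-‿cong (contract-zero (φ ∘ suc) I)))
    (solve 1 (λ v → con +0 :* v :- con +0 := con +0) refl _)
  contract-vacuum φ (outside ∷ I) = trans
    (+-congˡ (contract-vacuum (φ ∘ suc) I))
    (solve 1 (λ a → a :* con +0 :+ con +0 := con +0) refl _)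

-- Subsets

∣insert∣ : ∀ {m} (S : Subset m) t → lookup S t ≡ outside → ∣ S [ t ]≔ inside ∣ ≡ suc ∣ S ∣
∣insert∣ (outside ∷ S) zero    _   = ≡.refl
∣insert∣ (inside  ∷ S) (suc t) t∉S = ≡.cong suc (∣insert∣ S t t∉S)
∣insert∣ (outside ∷ S) (suc t) t∉S = ∣insert∣ S t t∉S

∣delete∣ : ∀ {m} (S : Subset m) t → lookup S t ≡ inside → suc ∣ S [ t ]≔ outside ∣ ≡ ∣ S ∣
∣delete∣ (inside  ∷ S) zero    _   = ≡.refl
∣delete∣ (inside  ∷ S) (suc t) t∈S = ≡.cong suc (∣delete∣ S t t∈S)
∣delete∣ (outside ∷ S) (suc t) t∈S = ∣delete∣ S t t∈S

⊆∧∣∣≡⇒≡ : ∀ {m} (p q : Subset m) → p ⊆ q → ∣ p ∣ ≡ ∣ q ∣ → p ≡ q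
⊆∧∣∣≡⇒≡ []            []            _   _  = ≡.refl
⊆∧∣∣≡⇒≡ (inside  ∷ p) (inside  ∷ q) p⊆q eq =
  ≡.cong (inside ∷_) (⊆∧∣∣≡⇒≡ p q (drop-∷-⊆ p⊆q) (ℕₚ.suc-injective eq))
⊆∧∣∣≡⇒≡ (inside  ∷ p) (outside ∷ q) p⊆q eq with () ← p⊆q here
⊆∧∣∣≡⇒≡ (outside ∷ p) (inside  ∷ q) p⊆q eq =
  contradiction (≡.subst (ℕ._≤ ∣ q ∣) eq (p⊆q⇒∣p∣≤∣q∣ (drop-∷-⊆ p⊆q))) ℕₚ.1+n≰n
⊆∧∣∣≡⇒≡ (outside ∷ p) (outside ∷ q) p⊆q eq =
  ≡.cong (outside ∷_) (⊆∧∣∣≡⇒≡ p q (drop-∷-⊆ p⊆q) eq)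

∉⇒lookup : ∀ {m} (S : Subset m) t → t ∉ S → lookup S t ≡ outside
∉⇒lookup S t t∉S with lookup S t in eq
... | inside  = contradiction (lookup⇒[]= t S eq) t∉S
... | outside = ≡.refl

lookup⇒∉ : ∀ {m} (S : Subset m) t → lookup S t ≡ outside → t ∉ S
lookup⇒∉ S t eq t∈S with () ← ≡.trans (≡.sym eq) ([]=⇒lookup t∈S)

-- A relation rather than the function `enum`: the length `k` stays independent of `∣ I ∣`, and
-- values are fixed only pointwise, so `c ∘ punchIn l` again enumerates a subset without transport
-- along equations.
data Enumerates : ∀ {m k} → (Fin k → Fin m) → Subset m → Set where
  []  : ∀ {c : Fin 0 → Fin 0} → Enumerates c []
  in∷ : ∀ {m k} {c : Fin (suc k) → Fin (suc m)} {c′ I} →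
        c zero ≡ zero → (∀ l → c (suc l) ≡ suc (c′ l)) →
        Enumerates c′ I → Enumerates c (inside ∷ I)
  out∷ : ∀ {m k} {c : Fin k → Fin (suc m)} {c′ I} →
        (∀ l → c l ≡ suc (c′ l)) →
        Enumerates c′ I → Enumerates c (outside ∷ I)

enum-enumerates : ∀ {m} (I : Subset m) → Enumerates (enum I) I
enum-enumerates []            = []
enum-enumerates (inside  ∷ I) = in∷ ≡.refl (λ _ → ≡.refl) (enum-enumerates I)
enum-enumerates (outside ∷ I) = out∷ (λ _ → ≡.refl) (enum-enumerates I)

∁-involutive : ∀ {m} (S : Subset m) → ∁ (∁ S) ≡ S
∁-involutive []      = ≡.refl
∁-involutive (b ∷ S) = ≡.cong₂ _∷_ (not-involutive b) (∁-involutive S)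

∣p∣+∣∁p∣≡n : ∀ {m} (S : Subset m) → ∣ S ∣ ℕ.+ ∣ ∁ S ∣ ≡ m
∣p∣+∣∁p∣≡n []            = ≡.refl
∣p∣+∣∁p∣≡n (inside  ∷ S) = ≡.cong suc (∣p∣+∣∁p∣≡n S)
∣p∣+∣∁p∣≡n (outside ∷ S) = ≡.trans (ℕₚ.+-suc ∣ S ∣ ∣ ∁ S ∣) (≡.cong suc (∣p∣+∣∁p∣≡n S))

∣++∣ : ∀ {a b} (S : Subset a) (S′ : Subset b) → ∣ S ++ S′ ∣ ≡ ∣ S ∣ ℕ.+ ∣ S′ ∣
∣++∣ []            S′ = ≡.refl
∣++∣ (inside  ∷ S) S′ = ≡.cong suc (∣++∣ S S′)
∣++∣ (outside ∷ S) S′ = ∣++∣ S S′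

↑-elim : ∀ {p} a {b} {P : Fin (a ℕ.+ b) → Set p} →
  (∀ i → P (i ↑ˡ b)) → (∀ i → P (a ↑ʳ i)) → ∀ j → P j
↑-elim a {b} {P} l r j with splitAt a j | join-splitAt a b j
... | inj₁ i | eq = ≡.subst P eq (l i)
... | inj₂ i | eq = ≡.subst P eq (r i)

-- The map on index sets and its fixed transversals

module _ (n : ℕ) .{{_ : NonZero n}} where

  -- `𝓡` without the cardinality proof, so that a form can be precomposed with it.
  ℛ : Subset (n ℕ.+ n) → Subset (n ℕ.+ n)
  ℛ U = image (ρ n) (∁ U)

  lookup-ℛ : ∀ U j → lookup (ℛ U) j ≡ not (lookup U (ρ n j))
  lookup-ℛ U j = begin
    lookup (ℛ U) j                            ≡⟨ ≡.cong (λ V → lookup V j) (image-ρ n (∁ U)) ⟩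
    lookup (tabulate (lookup (∁ U) ∘ ρ n)) j  ≡⟨ lookup∘tabulate (lookup (∁ U) ∘ ρ n) j ⟩
    lookup (∁ U) (ρ n j)                      ≡⟨ lookup-map (ρ n j) not U ⟩
    not (lookup U (ρ n j))                    ∎
    where open ≡.≡-Reasoning

  ℛ-++ : ∀ (S S′ : Subset n) → ℛ (S ++ S′) ≡ ∁ S′ ++ ∁ S
  ℛ-++ S S′ = ≡.trans (≡.sym (tabulate∘lookup _))
    (≡.trans (tabulate-cong (↑-elim n left right)) (tabulate∘lookup _))
    where
    open ≡.≡-Reasoning
    left : ∀ i → lookup (ℛ (S ++ S′)) (i ↑ˡ n) ≡ lookup (∁ S′ ++ ∁ S) (i ↑ˡ n)
    left i = begin
      lookup (ℛ (S ++ S′)) (i ↑ˡ n)         ≡⟨ lookup-ℛ (S ++ S′) (i ↑ˡ n) ⟩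
      not (lookup (S ++ S′) (ρ n (i ↑ˡ n))) ≡⟨ ≡.cong (not ∘ lookup (S ++ S′)) (ρ-↑ˡ n i) ⟩
      not (lookup (S ++ S′) (n ↑ʳ i))       ≡⟨ ≡.cong not (lookup-++ʳ S S′ i) ⟩
      not (lookup S′ i)                     ≡⟨ lookup-map i not S′ ⟨
      lookup (∁ S′) i                       ≡⟨ lookup-++ˡ (∁ S′) (∁ S) i ⟨
      lookup (∁ S′ ++ ∁ S) (i ↑ˡ n)         ∎
    right : ∀ i → lookup (ℛ (S ++ S′)) (n ↑ʳ i) ≡ lookup (∁ S′ ++ ∁ S) (n ↑ʳ i)
    right i = begin
      lookup (ℛ (S ++ S′)) (n ↑ʳ i)         ≡⟨ lookup-ℛ (S ++ S′) (n ↑ʳ i) ⟩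
      not (lookup (S ++ S′) (ρ n (n ↑ʳ i))) ≡⟨ ≡.cong (not ∘ lookup (S ++ S′)) (ρ-↑ʳ n i) ⟩
      not (lookup (S ++ S′) (i ↑ˡ n))       ≡⟨ ≡.cong not (lookup-++ˡ S S′ i) ⟩
      not (lookup S i)                      ≡⟨ lookup-map i not S ⟨
      lookup (∁ S) i                        ≡⟨ lookup-++ʳ (∁ S′) (∁ S) i ⟨
      lookup (∁ S′ ++ ∁ S) (n ↑ʳ i)         ∎

  ρ-irreflexive : ∀ j → ρ n j ≢ j
  ρ-irreflexive = ↑-elim n
    (λ i eq → different i i (≡.trans (≡.sym eq) (ρ-↑ˡ n i)))
    (λ i eq → different i i (≡.trans (≡.sym (ρ-↑ʳ n i)) eq))
    where
    different : ∀ (i l : Fin n) → i ↑ˡ n ≢ n ↑ʳ l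
    different i l eq with () ← ≡.trans (≡.sym (splitAt-↑ˡ n i n)) (≡.trans (≡.cong (splitAt n) eq) (splitAt-↑ʳ n n l))

  -- At most one element of each pair {j, ρ(j)}: a condition that holds for the empty set and can be
  -- maintained while pivots are added. Size n then forces exactly one.
  Transversal : Subset (n ℕ.+ n) → Set
  Transversal T = ∀ j → lookup T j ≡ inside → lookup T (ρ n j) ≡ outside

  transversal-⊥ : Transversal ⊥
  transversal-⊥ j j∈ = contradiction (≡.trans (≡.sym (lookup-replicate j outside)) j∈) λ ()

  transversal-insert : ∀ T j → Transversal T → lookup T j ≡ outside → lookup T (ρ n j) ≡ outside →
    Transversal (T [ j ]≔ inside)
  transversal-insert T j trv j∉T ρj∉T i i∈ with i ≟ᶠ j
  ... | yes ≡.refl = ≡.trans (lookup∘update′ (ρ-irreflexive j) T inside) ρj∉T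
  ... | no  i≢j    = ≡.trans (lookup∘update′ ρi≢j T inside) (trv i i∈T)
    where
    i∈T : lookup T i ≡ inside
    i∈T = ≡.trans (≡.sym (lookup∘update′ i≢j T inside)) i∈
    ρi≢j : ρ n i ≢ j
    ρi≢j eq with () ← ≡.trans (≡.sym i∈T) (≡.trans (≡.cong (lookup T) (≡.trans (≡.sym (ρ-involutive n i)) (≡.cong (ρ n) eq))) ρj∉T)

  -- Transversality is the inclusion of `T` in `ℛ T`, and both have n elements.
  transversal-fixed : ∀ {T} → Transversal T → ∣ T ∣ ≡ n → ℛ T ≡ T
  transversal-fixed {T} trv ∣T∣≡n = ≡.sym (⊆∧∣∣≡⇒≡ T (ℛ T)
    (λ {j} j∈T → lookup⇒[]= j (ℛ T) (≡.trans (lookup-ℛ T j) (≡.cong not (trv j ([]=⇒lookup j∈T)))))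
    (≡.trans ∣T∣≡n (≡.sym (proj₂ (𝓡 {n} (T , ∣T∣≡n))))))

-- Plücker vectors

module Plücker {c ℓ₁ ℓ₂ : Level} (ℝ : RealNumbers c ℓ₁ ℓ₂) where

  open RealNumbers ℝ using (commutativeRing; heytingField; _#_; tight; #-irrefl; #⇒invertible; sum; _^_)
  open CommutativeRing commutativeRing hiding (zero)
  open import Algebra.Apartness.Properties.HeytingCommutativeRing
    (HeytingField.heytingCommutativeRing heytingField)
    using (1#0; x-0≈x; x#0y#0→xy#0; #-congʳ)
  open import Algebra.Properties.Semiring.Sum semiring
    using (sum-cong-≋; ∑-distrib-+; *-distribˡ-sum)
  open IntegerSolver commutativeRing using (solve; _:=_; _:+_; _:*_; _:-_; :-_; con)
  open import Relation.Binary.Reasoning.Setoid setoid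
  open Clifford commutativeRing public
  open Grassmannian ℝ

  private variable
    k m n : ℕ

  -- Minors as coefficients of iterated exterior products

  plücker : Matrix k m → Form m
  plücker {zero}  A = vacuum
  plücker {suc k} A = wedge (A zero) (plücker (A ∘ suc))

  vacuum-enum : ∀ {c : Fin 0 → Fin m} {I} → Enumerates c I → vacuum I ≈ 1#
  vacuum-enum []         = refl
  vacuum-enum (out∷ _ e) = vacuum-enum e

  wedge-enum-empty : ∀ (x : Vector Carrier m) (P : Form m) {c : Fin 0 → Fin m} {I} →
    Enumerates c I → wedge x P I ≈ 0#
  wedge-enum-empty x P []         = refl
  wedge-enum-empty x P (out∷ _ e) = trans
    (+-congˡ (wedge-enum-empty (x ∘ suc) _ e))
    (solve 1 (λ p → con +0 :* p :+ con +0 := con +0) refl _)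

  det-cong : ∀ {A B : Matrix k k} → (∀ i j → A i j ≈ B i j) → det A ≈ det B
  det-cong {zero}  A≈B = refl
  det-cong {suc k} A≈B = sum-cong-≋ λ j →
    *-congˡ {(- 1#) ^ toℕ j} (*-cong (A≈B zero j) (det-cong λ i l → A≈B (suc i) (punchIn j l)))

  -- Laplace expansion along the first row, `f l` being the minor that omits the column at position
  -- `l`. Quantifying over every `I′` enumerated by `c ∘ punchIn l` avoids constructing the subset
  -- with that element removed.
  wedge-expand : ∀ (x : Vector Carrier m) (P : Form m) {c : Fin (suc k) → Fin m} {I}
    (f : Fin (suc k) → Carrier) → Enumerates c I →
    (∀ l I′ → Enumerates (c ∘ punchIn l) I′ → P I′ ≈ f l) →
    wedge x P I ≈ sum λ l → (- 1#) ^ toℕ l * (x (c l) * f l)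
  wedge-expand {k = k} x P {c} {inside ∷ I} f (in∷ {c′ = c′} c0 cs e) h =
    +-cong first (rest k ≡.refl)
    where
    first : x zero * P (outside ∷ I) ≈ 1# * (x (c zero) * f zero)
    first = trans (*-cong (reflexive (≡.cong x (≡.sym c0))) (h zero (outside ∷ I) (out∷ cs e)))
                  (sym (*-identityˡ _))
    -- The recursive call needs a nonempty enumeration, hence the split on `k`.
    rest : ∀ k′ → k ≡ k′ → - wedge (x ∘ suc) (P ∘ (inside ∷_)) I ≈
      sum λ l → (- 1#) ^ suc (toℕ l) * (x (c (suc l)) * f (suc l))
    rest zero     ≡.refl = trans (-‿cong (wedge-enum-empty (x ∘ suc) _ e))
                                 (solve 0 (:- con +0 := con +0) refl)
    rest (suc k″) ≡.refl = begin
      - wedge (x ∘ suc) (P ∘ (inside ∷_)) I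
        ≈⟨ -‿cong (wedge-expand (x ∘ suc) (P ∘ (inside ∷_)) (f ∘ suc) e λ l I′ e′ →
             h (suc l) (inside ∷ I′) (in∷ c0 (λ j → cs (punchIn l j)) e′)) ⟩
      - sum (λ l → (- 1#) ^ toℕ l * (x (suc (c′ l)) * f (suc l)))
        ≈⟨ solve 1 (λ s → :- s := (:- con (+ 1)) :* s) refl _ ⟩
      - 1# * sum (λ l → (- 1#) ^ toℕ l * (x (suc (c′ l)) * f (suc l)))
        ≈⟨ *-distribˡ-sum (- 1#) (λ l → (- 1#) ^ toℕ l * (x (suc (c′ l)) * f (suc l))) ⟩
      sum (λ l → - 1# * ((- 1#) ^ toℕ l * (x (suc (c′ l)) * f (suc l))))
        ≈⟨ sum-cong-≋ (λ l → trans (sym (*-assoc (- 1#) ((- 1#) ^ toℕ l) (x (suc (c′ l)) * f (suc l))))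
             (*-congˡ {(- 1#) ^ suc (toℕ l)} (*-congʳ {f (suc l)} (reflexive (≡.cong x (≡.sym (cs l))))))) ⟩
      sum (λ l → (- 1#) ^ suc (toℕ l) * (x (c (suc l)) * f (suc l)))  ∎
  wedge-expand x P {c} {outside ∷ I} f (out∷ {c′ = c′} cs e) h = begin
    0# * P (inside ∷ I) + wedge (x ∘ suc) (P ∘ (outside ∷_)) I
      ≈⟨ solve 2 (λ p a → con +0 :* p :+ a := a) refl _ _ ⟩
    wedge (x ∘ suc) (P ∘ (outside ∷_)) I
      ≈⟨ wedge-expand (x ∘ suc) (P ∘ (outside ∷_)) f e (λ l I′ e′ →
           h l (outside ∷ I′) (out∷ (λ j → cs (punchIn l j)) e′)) ⟩
    sum (λ l → (- 1#) ^ toℕ l * (x (suc (c′ l)) * f l))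
      ≈⟨ sum-cong-≋ (λ l → *-congˡ {(- 1#) ^ toℕ l} (*-congʳ {f l} (reflexive (≡.cong x (≡.sym (cs l)))))) ⟩
    sum (λ l → (- 1#) ^ toℕ l * (x (c l) * f l))  ∎

  plücker≈det : ∀ (A : Matrix k m) {c : Fin k → Fin m} {I} → Enumerates c I →
    plücker A I ≈ det λ i j → A i (c j)
  plücker≈det {zero}  A e = vacuum-enum e
  plücker≈det {suc k} A e = wedge-expand (A zero) (plücker (A ∘ suc)) _ e
    λ l I′ e′ → plücker≈det (A ∘ suc) e′

  minor≈plücker : ∀ (A : Matrix k m) (I : kSubset k m) → minor A I ≈ plücker A (proj₁ I)
  minor≈plücker {m = m} A (I , ∣I∣≡k) = casted ∣I∣≡k (enum I) (enum-enumerates I)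
    where
    -- Once `∣ I ∣` is generalised to a variable, the equation can be matched with `refl` and the
    -- cast disappears.
    casted : ∀ {k′} (eq : k′ ≡ _) (c : Fin k′ → Fin m) → Enumerates c I →
      det (λ i j → A (cast eq i) (c j)) ≈ plücker A I
    casted ≡.refl c e = trans
      (det-cong λ i j → reflexive (≡.cong (λ i → A i (c j)) (cast-is-id ≡.refl i)))
      (sym (plücker≈det A e))

  -- Anticommutation moves the contraction past each row at the cost of the pairing with that row,
  -- which is zero, until it reaches the vacuum and kills it.
  contract-plücker : ∀ (A : Matrix k m) φ → (∀ i → pairing φ (A i) ≈ 0#) →
    ∀ I → contract φ (plücker A) I ≈ 0#
  contract-plücker {zero}  A φ _    I = contract-vacuum φ I
  contract-plücker {suc k} {m} A φ φA≈0 I = begin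
    contract φ (wedge a P) I
      ≈⟨ solve 2 (λ u v → u := (u :+ v) :- v) refl _ (wedge a (contract φ P) I) ⟩
    (contract φ (wedge a P) I + wedge a (contract φ P) I) - wedge a (contract φ P) I
      ≈⟨ +-cong (clifford-anticomm _ φ a _ P I) (-‿cong (wedge-vanish a (contract φ P) I λ j _ →
           trans (*-congˡ (contract-plücker (A ∘ suc) φ (φA≈0 ∘ suc) (I [ j ]≔ outside))) (zeroʳ _))) ⟩
    (pairing φ a + pairing {m} (const 0#) (const 0#)) * P I - 0#
      ≈⟨ +-congʳ (*-congʳ (+-cong (φA≈0 zero) (sum-zero {m} _ λ _ → zeroˡ 0#))) ⟩
    (0# + 0#) * P I - 0#
      ≈⟨ solve 1 (λ p → (con +0 :+ con +0) :* p :- con +0 := con +0) refl _ ⟩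
    0#  ∎
    where a = A zero ; P = plücker (A ∘ suc)

  -- Row spaces

  sum∈ : ∀ (V : Subspace m) (f : Fin k → Vector Carrier m) →
    (∀ i → Subspace.member V (f i)) → Subspace.member V (λ j → sum λ i → f i j)
  sum∈ {k = zero}  V f f∈ = Subspace.zero∈ V
  sum∈ {k = suc k} V f f∈ = Subspace.+∈ V (f∈ zero) (sum∈ V (f ∘ suc) (f∈ ∘ suc))

  span : Matrix k m → Subspace m
  span A = record
    { member = λ x → ∃ λ a → ∀ j → x j ≈ linearCombination a A j
    ; resp   = λ { x≈y (a , x≈) → a , λ j → trans (sym (x≈y j)) (x≈ j) }
    ; zero∈  = const 0# , λ j → sym (sum-zero (λ i → 0# * A i j) λ i → zeroˡ _)
    ; +∈     = λ { (a , x≈) (b , y≈) → (λ i → a i + b i) , λ j → begin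
        _                                        ≈⟨ +-cong (x≈ j) (y≈ j) ⟩
        sum (λ i → a i * A i j) + sum (λ i → b i * A i j)
          ≈⟨ ∑-distrib-+ (λ i → a i * A i j) (λ i → b i * A i j) ⟨
        sum (λ i → a i * A i j + b i * A i j)    ≈⟨ sum-cong-≋ (λ i → distribʳ (A i j) (a i) (b i)) ⟨
        sum (λ i → (a i + b i) * A i j)          ∎ }
    ; *∈     = λ { t (a , x≈) → (λ i → t * a i) , λ j → begin
        _                                        ≈⟨ *-congˡ (x≈ j) ⟩
        t * sum (λ i → a i * A i j)              ≈⟨ *-distribˡ-sum t (λ i → a i * A i j) ⟩
        sum (λ i → t * (a i * A i j))            ≈⟨ sum-cong-≋ (λ i → *-assoc t (a i) (A i j)) ⟨
        sum (λ i → (t * a i) * A i j)            ∎ }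
    }

  infix 4 _∈ᵛ_
  _∈ᵛ_ : Vector Carrier m → Subspace m → Set (c ⊔ ℓ₁)
  x ∈ᵛ V = Subspace.member V x

  span-least : ∀ (A : Matrix k m) (V : Subspace m) → (∀ i → A i ∈ᵛ V) → ∀ {x} → x ∈ᵛ span A → x ∈ᵛ V
  span-least A V A∈V (a , x≈) = Subspace.resp V (λ j → sym (x≈ j))
    (sum∈ V (λ i j → a i * A i j) λ i → Subspace.*∈ V (a i) (A∈V i))

  row∈span : ∀ (A : Matrix k m) i → A i ∈ᵛ span A
  row∈span A i = δ , λ j → sym (begin
    sum (λ l → δ l * A l j)   ≈⟨ sum-single (λ l → δ l * A l j) i (λ l l≢i → trans (*-congʳ (δ-off l l≢i)) (zeroˡ _)) ⟩
    δ i * A i j               ≈⟨ *-congʳ δ-on ⟩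
    1# * A i j                ≈⟨ *-identityˡ _ ⟩
    A i j                     ∎)
    where
    δ : Vector Carrier _
    δ l with l ≟ᶠ i
    ... | yes _ = 1#
    ... | no  _ = 0#
    δ-on : δ i ≈ 1#
    δ-on with i ≟ᶠ i
    ... | yes _   = refl
    ... | no  i≢i = contradiction ≡.refl i≢i
    δ-off : ∀ l → l ≢ i → δ l ≈ 0#
    δ-off l l≢i with l ≟ᶠ i
    ... | yes l≡i = contradiction l≡i l≢i
    ... | no  _   = refl

  wedge-zeroᵥ : ∀ (P : Form m) I → wedge (const 0#) P I ≈ 0#
  wedge-zeroᵥ P I = wedge-vanish (const 0#) P I λ j _ → zeroˡ _

  wedge-linearCombination : ∀ (A : Matrix k m) (P : Form m) →
    (∀ i I → wedge (A i) P I ≈ 0#) → ∀ {x} → x ∈ᵛ span A → ∀ I → wedge x P I ≈ 0#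
  wedge-linearCombination {k} {m} A P h {x} (a , x≈) I = trans
    (clifford-cong x≈ (λ _ → refl) (λ _ → refl) I) (go a A h)
    where
    go : ∀ {k} (a : Vector Carrier k) (A : Matrix k m) → (∀ i I → wedge (A i) P I ≈ 0#) →
      wedge (linearCombination a A) P I ≈ 0#
    go {zero}  a A h = wedge-zeroᵥ P I
    go {suc k} a A h = begin
      wedge (linearCombination a A) P I
        ≈⟨ wedge-axpyᵥ (a zero) (A zero) (linearCombination (a ∘ suc) (A ∘ suc)) P I ⟩
      a zero * wedge (A zero) P I + wedge (linearCombination (a ∘ suc) (A ∘ suc)) P I
        ≈⟨ +-cong (*-congˡ (h zero I)) (go (a ∘ suc) (A ∘ suc) (h ∘ suc)) ⟩
      a zero * 0# + 0#
        ≈⟨ solve 1 (λ a → a :* con +0 :+ con +0 := con +0) refl _ ⟩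
      0#  ∎

  -- The row anticommutes with those before it until it meets its own copy, where the square
  -- vanishes.
  wedge-plücker : ∀ (A : Matrix k m) i I → wedge (A i) (plücker A) I ≈ 0#
  wedge-plücker         A zero    I = wedge² (A zero) (plücker (A ∘ suc)) I
  wedge-plücker {m = m} A (suc i) I = begin
    wedge b (wedge a P) I
      ≈⟨ solve 2 (λ u v → u := (u :+ v) :- v) refl _ (wedge a (wedge b P) I) ⟩
    (wedge b (wedge a P) I + wedge a (wedge b P) I) - wedge a (wedge b P) I
      ≈⟨ +-cong (clifford-anticomm b _ a _ P I) (-‿cong (wedge-vanish a (wedge b P) I λ j _ →
           trans (*-congˡ (wedge-plücker (A ∘ suc) i (I [ j ]≔ outside))) (zeroʳ _))) ⟩
    (pairing (const 0#) a + pairing (const 0#) b) * P I - 0#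
      ≈⟨ +-congʳ (*-congʳ (+-cong (sum-zero (λ j → 0# * a j) λ _ → zeroˡ _)
                                  (sum-zero (λ j → 0# * b j) λ _ → zeroˡ _))) ⟩
    (0# + 0#) * P I - 0#
      ≈⟨ solve 1 (λ p → (con +0 :+ con +0) :* p :- con +0 := con +0) refl _ ⟩
    0#  ∎
    where a = A zero ; b = A (suc i) ; P = plücker (A ∘ suc)

  wedge-span : ∀ (A : Matrix k m) {x} → x ∈ᵛ span A → ∀ I → wedge x (plücker A) I ≈ 0#
  wedge-span A = wedge-linearCombination A (plücker A) (wedge-plücker A)

  -- Cancellation, and Gaussian elimination up to double negation

  #0-unit-cancel : ∀ {x y} → x # 0# → y * x ≈ 0# → y ≈ 0#
  #0-unit-cancel {x} {y} x#0 yx≈0 with #⇒invertible x#0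
  ... | x⁻¹ , _ , x*x⁻¹≈1 = begin
    y                      ≈⟨ *-identityʳ y ⟨
    y * 1#                 ≈⟨ *-congˡ x*x⁻¹≈1 ⟨
    y * ((x - 0#) * x⁻¹)   ≈⟨ solve 3 (λ x y z → y :* ((x :- con +0) :* z) := (y :* x) :* z) refl x y x⁻¹ ⟩
    (y * x) * x⁻¹          ≈⟨ *-congʳ yx≈0 ⟩
    0# * x⁻¹               ≈⟨ zeroˡ _ ⟩
    0#                     ∎

  #0-cancelˡ : ∀ {t a b} → t # 0# → t * a ≈ t * b → a ≈ b
  #0-cancelˡ {t} {a} {b} t#0 ta≈tb = begin
    a            ≈⟨ solve 2 (λ a b → a := b :+ (a :- b)) refl a b ⟩
    b + (a - b)  ≈⟨ +-congˡ (#0-unit-cancel t#0 (begin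
      (a - b) * t    ≈⟨ solve 3 (λ a b t → (a :- b) :* t := t :* a :- t :* b) refl a b t ⟩
      t * a - t * b  ≈⟨ +-congʳ ta≈tb ⟩
      t * b - t * b  ≈⟨ -‿inverseʳ _ ⟩
      0#             ∎)) ⟩
    b + 0#       ≈⟨ +-identityʳ b ⟩
    b            ∎

  -- A sign is its own inverse; this is what makes the signs of the intertwining harmless.
  sign-cancel : ∀ {s y} → s * s ≈ 1# → s * y ≈ 0# → y ≈ 0#
  sign-cancel {s} {y} s² sy≈0 = begin
    y             ≈⟨ *-identityˡ y ⟨
    1# * y        ≈⟨ *-congʳ s² ⟨
    (s * s) * y   ≈⟨ *-assoc s s y ⟩
    s * (s * y)   ≈⟨ *-congˡ sy≈0 ⟩
    s * 0#        ≈⟨ zeroʳ s ⟩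
    0#            ∎

  sign#0 : ∀ {s} → s * s ≈ 1# → s # 0#
  sign#0 {s} s² = invertible⇒# (s , trans (*-congˡ (x-0≈x s)) s² , trans (*-congʳ (x-0≈x s)) s²)
    where open RealNumbers ℝ using (invertible⇒#)

  -- A reduced row echelon basis of the row space of A with pivot columns T.
  record Pivoted (A : Matrix k m) (T : Subset m) : Set (c ⊔ ℓ₁ ⊔ ℓ₂) where
    field
      card      : ∣ T ∣ ≡ k
      nonzero   : plücker A T # 0#
      -- Rows are named by their pivot column, which avoids enumerating `T`; the conditions concern
      -- `t` in `T`.
      row       : Matrix m m
      row∈      : ∀ t → lookup T t ≡ inside → row t ∈ᵛ span A
      row-pivot : ∀ t → lookup T t ≡ inside → row t t ≈ 1#
      row-other : ∀ t u → lookup T t ≡ inside → lookup T u ≡ inside → t ≢ u → row t u ≈ 0#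

  -- One elimination step. The vector `y` is the new first row cleared at the old pivots, and `j` is
  -- a column where it is apart from zero. Normalising `y` gives the row at `j`; subtracting
  -- multiples of it clears column `j` in the old rows and leaves their pivots intact.
  module _ {A : Matrix (suc k) m} {T} (piv : Pivoted (A ∘ suc) T)
    {y u : Vector Carrier m} (u∈ : u ∈ᵛ span (A ∘ suc)) (y≈ : ∀ j → y j ≈ A zero j + u j)
    (y≈0 : ∀ t → lookup T t ≡ inside → y t ≈ 0#)
    {j} (j∉T : lookup T j ≡ outside) (yⱼ#0 : y j # 0#) where

    private
      open Pivoted piv
      yⱼ⁻¹ = proj₁ (#⇒invertible yⱼ#0)
      T′ = T [ j ]≔ inside
      P = plücker (A ∘ suc)

      ŷ : Vector Carrier m
      ŷ l = yⱼ⁻¹ * y l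

      ŷⱼ≈1 : ŷ j ≈ 1#
      ŷⱼ≈1 = trans (*-congˡ (sym (x-0≈x _))) (proj₁ (proj₂ (#⇒invertible yⱼ#0)))

      ⊆span : ∀ {x} → x ∈ᵛ span (A ∘ suc) → x ∈ᵛ span A
      ⊆span = span-least (A ∘ suc) (span A) (row∈span A ∘ suc)

      y∈ : y ∈ᵛ span A
      y∈ = Subspace.resp (span A) (λ l → sym (y≈ l)) (Subspace.+∈ (span A) (row∈span A zero) (⊆span u∈))

      T′⇒T : ∀ t → t ≢ j → lookup T′ t ≡ inside → lookup T t ≡ inside
      T′⇒T t t≢j = ≡.trans (≡.sym (lookup∘update′ t≢j T inside))

      row′ : Matrix m m
      row′ t with t ≟ᶠ j
      ... | yes _ = ŷ
      ... | no  _ = λ l → row t l + (- row t j) * ŷ l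

      row∈′ : ∀ t → lookup T′ t ≡ inside → row′ t ∈ᵛ span A
      row∈′ t t∈ with t ≟ᶠ j
      ... | yes _   = Subspace.*∈ (span A) yⱼ⁻¹ y∈
      ... | no  t≢j = Subspace.+∈ (span A) (⊆span (row∈ t (T′⇒T t t≢j t∈)))
                        (Subspace.*∈ (span A) (- row t j) (Subspace.*∈ (span A) yⱼ⁻¹ y∈))

      ŷ≈0 : ∀ t → lookup T t ≡ inside → ŷ t ≈ 0#
      ŷ≈0 t t∈ = trans (*-congˡ (y≈0 t t∈)) (zeroʳ _)

      row-pivot′ : ∀ t → lookup T′ t ≡ inside → row′ t t ≈ 1#
      row-pivot′ t t∈ with t ≟ᶠ j
      ... | yes ≡.refl = ŷⱼ≈1
      ... | no  t≢j    = begin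
        row t t + (- row t j) * ŷ t  ≈⟨ +-cong (row-pivot t (T′⇒T t t≢j t∈)) (*-congˡ (ŷ≈0 t (T′⇒T t t≢j t∈))) ⟩
        1# + (- row t j) * 0#        ≈⟨ solve 1 (λ a → con (+ 1) :+ (:- a) :* con +0 := con (+ 1)) refl _ ⟩
        1#                           ∎

      row-other′ : ∀ t u → lookup T′ t ≡ inside → lookup T′ u ≡ inside → t ≢ u → row′ t u ≈ 0#
      row-other′ t u t∈ u∈ t≢u with t ≟ᶠ j
      ... | yes ≡.refl = ŷ≈0 u (T′⇒T u (t≢u ∘ ≡.sym) u∈)
      ... | no  t≢j with u ≟ᶠ j
      ...   | yes ≡.refl = trans (+-congˡ (*-congˡ ŷⱼ≈1))
                             (solve 1 (λ a → a :+ (:- a) :* con (+ 1) := con +0) refl _)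
      ...   | no  u≢j    = trans
              (+-cong (row-other t u (T′⇒T t t≢j t∈) (T′⇒T u u≢j u∈) t≢u) (*-congˡ (ŷ≈0 u (T′⇒T u u≢j u∈))))
              (solve 1 (λ a → con +0 :+ (:- a) :* con +0 := con +0) refl _)

      -- Adding `u` to the first row changes nothing because `u` wedges `P` to zero, and as `y`
      -- vanishes on `T` a single term of the expansion is left.
      plücker-T′ : plücker A T′ ≈ positionSign T j * (y j * P T)
      plücker-T′ = begin
        wedge (A zero) P T′
          ≈⟨ solve 1 (λ a → a := con (+ 1) :* a :+ con +0) refl _ ⟩
        1# * wedge (A zero) P T′ + 0#
          ≈⟨ +-congˡ (wedge-span (A ∘ suc) u∈ T′) ⟨
        1# * wedge (A zero) P T′ + wedge u P T′
          ≈⟨ wedge-axpyᵥ 1# (A zero) u P T′ ⟨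
        wedge (λ l → 1# * A zero l + u l) P T′
          ≈⟨ clifford-cong (λ l → trans (+-congʳ (*-identityˡ _)) (sym (y≈ l))) (λ _ → refl) (λ _ → refl) T′ ⟩
        wedge y P T′
          ≈⟨ wedge-insert y P T j j∉T (λ t t∈ → trans (*-congʳ (y≈0 t t∈)) (zeroˡ _)) ⟩
        positionSign T j * (y j * P T)  ∎

    insert-pivot : Pivoted A T′
    insert-pivot = record
      { card      = ≡.trans (∣insert∣ T j j∉T) (≡.cong suc card)
      ; nonzero   = #-congʳ (sym plücker-T′)
          (x#0y#0→xy#0 (sign#0 (positionSign² T j)) (x#0y#0→xy#0 yⱼ#0 nonzero))
      ; row       = row′
      ; row∈      = row∈′
      ; row-pivot = row-pivot′
      ; row-other = row-other′
      }

  -- Subtract `x t` times the pivot row at `t`, for each `t` in `T`. The rows being reduced, each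
  -- affects only its own pivot coordinate.
  reduce : ∀ {A : Matrix k m} {T} → Pivoted A T → ∀ (x : Vector Carrier m) →
    ∃ λ (u : Vector Carrier m) → u ∈ᵛ span A × (∀ t → lookup T t ≡ inside → x t + u t ≈ 0#)
  reduce {A = A} {T} piv x = u , u∈ , vanishes
    where
    open Pivoted piv
    f : Matrix _ _
    f t l = if lookup T t then (- x t) * row t l else 0#
    f∈ : ∀ t → f t ∈ᵛ span A
    f∈ t with lookup T t in eq
    ... | inside  = Subspace.*∈ (span A) (- x t) (row∈ t eq)
    ... | outside = Subspace.zero∈ (span A)
    u : Vector Carrier _
    u l = sum λ t → f t l
    u∈ : u ∈ᵛ span A
    u∈ = sum∈ (span A) f f∈
    f-pivot : ∀ t → lookup T t ≡ inside → f t t ≈ - x t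
    f-pivot t t∈ with lookup T t in eq | t∈
    ... | inside | _ = trans (*-congˡ (row-pivot t eq)) (*-identityʳ _)
    f-other : ∀ t → lookup T t ≡ inside → ∀ s → s ≢ t → f s t ≈ 0#
    f-other t t∈ s s≢t with lookup T s in eq
    ... | inside  = trans (*-congˡ (row-other s t eq t∈ s≢t)) (zeroʳ _)
    ... | outside = refl
    vanishes : ∀ t → lookup T t ≡ inside → x t + u t ≈ 0#
    vanishes t t∈ = trans
      (+-congˡ (trans (sum-single (λ s → f s t) t (f-other t t∈)) (f-pivot t t∈)))
      (-‿inverseʳ _)

  Independent : Matrix k m → Set (c ⊔ ℓ₁)
  Independent A = ∀ a → (∀ j → linearCombination a A j ≈ 0#) → ∀ i → a i ≈ 0#

  tail-independent : ∀ (A : Matrix (suc k) m) → Independent A → Independent (A ∘ suc)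
  tail-independent A ind a a≈0 i = ind (λ { zero → 0# ; (suc i) → a i })
    (λ j → trans (+-cong (zeroˡ (A zero j)) (a≈0 j)) (+-identityʳ 0#)) (suc i)

  head-independent : ∀ (A : Matrix (suc k) m) → Independent A → ∀ {u} → u ∈ᵛ span (A ∘ suc) →
    ¬ (∀ j → A zero j + u j ≈ 0#)
  head-independent A ind (a , u≈) y≈0 = #-irrefl
    (ind (λ { zero → 1# ; (suc i) → a i })
       (λ j → trans (+-cong (*-identityˡ _) (sym (u≈ j))) (y≈0 j)) zero)
    1#0

  -- Pivots are chosen greedily from the last row upwards so as to preserve `Good`. `extensible`
  -- excludes a dead end: a vector of `V` that is cleared on `T` and vanishes at every admissible
  -- new pivot is zero.
  module _ {g} (V : Subspace m) (Good : Subset m → Set g) (good-⊥ : Good ⊥)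
    (extensible : ∀ {k} {A : Matrix k m} {T} → (∀ i → A i ∈ᵛ V) → Good T → Pivoted A T →
      ∀ y → y ∈ᵛ V → (∀ t → lookup T t ≡ inside → y t ≈ 0#) →
      (∀ j → lookup T j ≡ outside → Good (T [ j ]≔ inside) → y j ≈ 0#) → ∀ j → y j ≈ 0#) where

    ¬¬∃-pivoted : (A : Matrix k m) → (∀ i → A i ∈ᵛ V) → Independent A →
      ¬ ¬ (∃ λ T → Good T × Pivoted A T)
    ¬¬∃-pivoted {zero}  A A∈V ind none = none (⊥ , good-⊥ , record
      { card      = ∣⊥∣≡0 m
      ; nonzero   = #-congʳ (sym (vacuum-⊥ m)) 1#0
      ; row       = λ _ _ → 0#
      ; row∈      = λ t t∈ → contradiction (≡.trans (≡.sym (lookup-replicate t outside)) t∈) λ ()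
      ; row-pivot = λ t t∈ → contradiction (≡.trans (≡.sym (lookup-replicate t outside)) t∈) λ ()
      ; row-other = λ t _ t∈ → contradiction (≡.trans (≡.sym (lookup-replicate t outside)) t∈) λ ()
      })
      where
      vacuum-⊥ : ∀ m → vacuum (⊥ {m}) ≈ 1#
      vacuum-⊥ zero    = refl
      vacuum-⊥ (suc m) = vacuum-⊥ m
    ¬¬∃-pivoted {suc k} A A∈V ind none =
      ¬¬∃-pivoted (A ∘ suc) (A∈V ∘ suc) (tail-independent A ind) λ { (T , good , piv) →
        let u , u∈ , y≈0 = reduce piv (A zero) in
        head-independent A ind u∈ (extensible (A∈V ∘ suc) good piv (λ j → A zero j + u j)
          (Subspace.+∈ V (A∈V zero) (span-least (A ∘ suc) V (A∈V ∘ suc) u∈))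
          y≈0
          -- An admissible column where the reduced row is apart from zero would contradict `none`.
          -- So all these entries vanish, the reduced row is zero by `extensible`, and independence
          -- fails.
          λ j j∉T good′ → proj₁ (tight _ _) λ yⱼ#0 →
            none (T [ j ]≔ inside , good′ , insert-pivot {A = A} piv u∈ (λ _ → refl) y≈0 j∉T yⱼ#0)) }

  -- Exchanging an element of S for a pivot outside S brings S closer to T.
  determined-by-pivots : ∀ {A : Matrix k m} {T} → Pivoted A T → (D : Form m) →
    (∀ x → x ∈ᵛ span A → ∀ I → ∣ I ∣ ≡ suc k → wedge x D I ≈ 0#) → D T ≈ 0# →
    ∀ S → ∣ S ∣ ≡ k → D S ≈ 0#
  determined-by-pivots {k} {m} {A} {T} piv D killed DT≈0 S = go _ S ℕₚ.≤-refl
    where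
    open Pivoted piv
    go : ∀ b S → ∣ T ∩ ∁ S ∣ ℕ.≤ b → ∣ S ∣ ≡ k → D S ≈ 0#
    go b S bound ∣S∣≡k with nonempty? (T ∩ ∁ S)
    ... | no  T∖S-empty = ≡.subst (λ S → D S ≈ 0#) (⊆∧∣∣≡⇒≡ T S T⊆S (≡.trans card (≡.sym ∣S∣≡k))) DT≈0
      where
      T⊆S : T ⊆ S
      T⊆S {t} t∈T = x∉∁p⇒x∈p λ t∈∁S → T∖S-empty (t , x∈p∩q⁺ (t∈T , t∈∁S))
    ... | yes (t , t∈T∖S) = exchange b bound
      where
      t∈T : lookup T t ≡ inside
      t∈T = []=⇒lookup (proj₁ (x∈p∩q⁻ T (∁ S) t∈T∖S))
      t∉S : lookup S t ≡ outside
      t∉S = ∉⇒lookup S t (x∈∁p⇒x∉p (proj₂ (x∈p∩q⁻ T (∁ S) t∈T∖S)))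
      ≢t : ∀ {j} → lookup S j ≡ inside → j ≢ t
      ≢t j∈S ≡.refl with () ← ≡.trans (≡.sym j∈S) t∉S
      S⁺ = S [ t ]≔ inside
      module _ {j} (j∈S : lookup S j ≡ inside) (j∉T : lookup T j ≡ outside) where
        S′ = S⁺ [ j ]≔ outside
        t∈S′ : t ∈ S′
        t∈S′ = lookup⇒[]= t S′ (≡.trans (lookup∘update′ (≢t j∈S ∘ ≡.sym) S⁺ outside) (lookup∘update t S inside))
        ∣S′∣≡k : ∣ S′ ∣ ≡ k
        ∣S′∣≡k = ℕₚ.suc-injective (≡.trans
          (∣delete∣ S⁺ j (≡.trans (lookup∘update′ (≢t j∈S) S inside) j∈S))
          (≡.trans (∣insert∣ S t t∉S) (≡.cong suc ∣S∣≡k)))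
        keeps : ∀ {i} → i ∈ T → i ∈ S → i ∈ S′
        keeps {i} i∈T i∈S = lookup⇒[]= i S′ (≡.trans (lookup∘update′ i≢j S⁺ outside)
            (≡.trans (lookup∘update′ (≢t ([]=⇒lookup i∈S)) S inside) ([]=⇒lookup i∈S)))
          where
          i≢j : i ≢ j
          i≢j ≡.refl = lookup⇒∉ T j j∉T i∈T
        closer : T ∩ ∁ S′ ⊂ T ∩ ∁ S
        closer = (λ {i} i∈ → let i∈T , i∈∁S′ = x∈p∩q⁻ T (∁ S′) i∈ in
                   x∈p∩q⁺ (i∈T , x∉p⇒x∈∁p λ i∈S → x∈∁p⇒x∉p i∈∁S′ (keeps i∈T i∈S)))
               , t , t∈T∖S , λ t∈ → x∈∁p⇒x∉p (proj₂ (x∈p∩q⁻ T (∁ S′) t∈)) t∈S′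
      exchange : ∀ b → ∣ T ∩ ∁ S ∣ ℕ.≤ b → D S ≈ 0#
      exchange zero    bound = contradiction (ℕₚ.≤-trans (p⊂q⇒∣p∣<∣q∣ {p = ⊥} (⊥⊆ , t , t∈T∖S , ∉⊥)) bound) λ ()
      exchange (suc b) bound = begin
        D S            ≈⟨ *-identityˡ _ ⟨
        1# * D S       ≈⟨ *-congʳ (row-pivot t t∈T) ⟨
        row t t * D S  ≈⟨ sign-cancel (positionSign² S t) (trans (sym expansion) (killed (row t) (row∈ t t∈T) S⁺
                            (≡.trans (∣insert∣ S t t∉S) (≡.cong suc ∣S∣≡k)))) ⟩
        0#             ∎
        where
        -- If `j` is a pivot, the reduced row at `t` vanishes there; otherwise trading `j` for `t`
        -- leaves fewer elements of `T` missing, and the induction applies.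
        term : ∀ j → lookup S j ≡ inside → row t j * D (S⁺ [ j ]≔ outside) ≈ 0#
        term j j∈S with lookup T j in eq
        ... | inside  = trans (*-congʳ (row-other t j t∈T eq (≢t j∈S ∘ ≡.sym))) (zeroˡ _)
        ... | outside = trans (*-congˡ (go b _
                (ℕ.s≤s⁻¹ (ℕₚ.≤-trans (p⊂q⇒∣p∣<∣q∣ (closer j∈S eq)) bound)) (∣S′∣≡k j∈S eq))) (zeroʳ _)
        expansion : wedge (row t) D S⁺ ≈ positionSign S t * (row t t * D S)
        expansion = wedge-insert (row t) D S t t∉S term

-- The form R

module Lagrangian {c ℓ₁ ℓ₂ : Level} (ℝ : RealNumbers c ℓ₁ ℓ₂) (n : ℕ) .{{_ : NonZero n}} where

  open RealNumbers ℝ using (commutativeRing; _#_; _≤_; tight; #-irrefl; sum; _^_; isStrictPartialOrder)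
  open CommutativeRing commutativeRing hiding (zero)
  open import Algebra.Properties.Semiring.Sum semiring
    using (sum-cong-≋; ∑-distrib-+)
  open IntegerSolver commutativeRing using (solve; _:=_; _:+_; _:*_; _:-_; :-_; con)
  open import Relation.Binary.Reasoning.Setoid setoid
  open Plücker ℝ
  open Grassmannian ℝ

  -- The covector R(x, ·) and its passage through complements

  τ : Fin (n ℕ.+ n) → Carrier
  τ j = [ (λ i → - ((- 1#) ^ toℕ i)) , (λ i → (- 1#) ^ toℕ i) ]′ (splitAt n j)

  τ-↑ˡ : ∀ i → τ (i ↑ˡ n) ≈ - ((- 1#) ^ toℕ i)
  τ-↑ˡ i rewrite splitAt-↑ˡ n i n = refl

  τ-↑ʳ : ∀ i → τ (n ↑ʳ i) ≈ (- 1#) ^ toℕ i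
  τ-↑ʳ i rewrite splitAt-↑ʳ n n i = refl

  τ² : ∀ j → τ j * τ j ≈ 1#
  τ² = ↑-elim n
    (λ i → trans (*-cong (τ-↑ˡ i) (τ-↑ˡ i))
             (trans (solve 1 (λ s → (:- s) :* (:- s) := s :* s) refl _) (power² (toℕ i))))
    (λ i → trans (*-cong (τ-↑ʳ i) (τ-↑ʳ i)) (power² (toℕ i)))
    where
    power² : ∀ l → (- 1#) ^ l * (- 1#) ^ l ≈ 1#
    power² zero    = *-identityˡ 1#
    power² (suc l) = trans
      (solve 1 (λ s → ((:- con (+ 1)) :* s) :* ((:- con (+ 1)) :* s) := s :* s) refl ((- 1#) ^ l))
      (power² l)

  -- The covector R(x, ·), as `pairing-ω` confirms.
  ω : Vector Carrier (n ℕ.+ n) → Vector Carrier (n ℕ.+ n)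
  ω x j = τ j * x (ρ n j)

  ω-↑ˡ : ∀ x i → ω x (i ↑ˡ n) ≈ - alternate (x ∘ (n ↑ʳ_)) i
  ω-↑ˡ x i = trans (*-cong (τ-↑ˡ i) (reflexive (≡.cong x (ρ-↑ˡ n i))))
    (solve 2 (λ s a → (:- s) :* a := :- (s :* a)) refl _ _)

  ω-↑ʳ : ∀ x i → ω x (n ↑ʳ i) ≈ alternate (x ∘ (_↑ˡ n)) i
  ω-↑ʳ x i = *-cong (τ-↑ʳ i) (reflexive (≡.cong x (ρ-↑ʳ n i)))

  pairing-ω : ∀ x y → pairing (ω x) y ≈ R n x y
  pairing-ω x y = begin
    pairing (ω x) y
      ≈⟨ sum-↑ n (λ j → ω x j * y j) ⟩
    sum (λ i → ω x (i ↑ˡ n) * y (i ↑ˡ n)) + sum (λ i → ω x (n ↑ʳ i) * y (n ↑ʳ i))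
      ≈⟨ ∑-distrib-+ (λ i → ω x (i ↑ˡ n) * y (i ↑ˡ n)) (λ i → ω x (n ↑ʳ i) * y (n ↑ʳ i)) ⟨
    sum (λ i → ω x (i ↑ˡ n) * y (i ↑ˡ n) + ω x (n ↑ʳ i) * y (n ↑ʳ i))
      ≈⟨ sum-cong-≋ (λ i → trans
           (+-cong (*-congʳ {y (i ↑ˡ n)} (ω-↑ˡ x i)) (*-congʳ {y (n ↑ʳ i)} (ω-↑ʳ x i)))
           (solve 5 (λ s a b c d → (:- (s :* c)) :* b :+ (s :* a) :* d := s :* (a :* d :- c :* b)) refl
              ((- 1#) ^ toℕ i) (x (i ↑ˡ n)) (y (i ↑ˡ n)) (x (n ↑ʳ i)) (y (n ↑ʳ i)))) ⟩
    R n x y  ∎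

  -- ℛ turns the exterior product by x into the contraction by R(x, ·).  On the
  -- two halves of the index set the signs differ by those of clifford-++, and
  -- the cardinality condition is what makes the two discrepancies agree.
  contract-ω : ∀ x (Q : Form (n ℕ.+ n)) (S S′ : Subset n) → ∣ S ∣ ≡ suc ∣ ∁ S′ ∣ →
    contract (ω x) Q (∁ S′ ++ ∁ S) ≈ - (paritySign S * wedge x (Q ∘ ℛ n) (S ++ S′))
  contract-ω x Q S S′ card = begin
    contract (ω x) Q (∁ S′ ++ ∁ S)
      ≈⟨ clifford-++ {n} (const 0#) (ω x) Q (∁ S′) (∁ S) ⟩
    contract (ω x ∘ (_↑ˡ n)) (λ U → Q (U ++ ∁ S)) (∁ S′) +
    paritySign (∁ S′) * contract (ω x ∘ (n ↑ʳ_)) (λ U → Q (∁ S′ ++ U)) (∁ S)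
      ≈⟨ +-cong
           (trans (clifford-cong {n} (λ _ → sym -0≈0) (ω-↑ˡ x) (λ _ → refl) (∁ S′))
                  (clifford-negᵥ {n} (const 0#) (alternate xʳ) (λ U → Q (U ++ ∁ S)) (∁ S′)))
           (*-cong ε′≈-ε (clifford-cong {n} (λ _ → refl) (ω-↑ʳ x) (λ _ → refl) (∁ S))) ⟩
    - B + (- ε) * A
      ≈⟨ solve 3 (λ a b s → :- b :+ (:- s) :* a := :- (s :* a :+ con (+ 1) :* b)) refl A B ε ⟩
    - (ε * A + 1# * B)
      -- Writing 1 as the square of `ε` exposes `ε` as a common factor.
      ≈⟨ -‿cong (+-congˡ (*-congʳ (paritySign² S))) ⟨
    - (ε * A + (ε * ε) * B)
      ≈⟨ solve 3 (λ a b s → :- (s :* a :+ (s :* s) :* b) := :- (s :* (a :+ s :* b))) refl A B ε ⟩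
    - (ε * (A + ε * B))
      ≈⟨ -‿cong (*-congˡ (+-cong left (*-congˡ right))) ⟨
    - (ε * (wedge xˡ (λ U → Q (ℛ n (U ++ S′))) S + ε * wedge xʳ (λ U → Q (ℛ n (S ++ U))) S′))
      ≈⟨ -‿cong (*-congˡ (clifford-++ {n} x (const 0#) (Q ∘ ℛ n) S S′)) ⟨
    - (ε * wedge x (Q ∘ ℛ n) (S ++ S′))  ∎
    where
    xˡ xʳ : Vector Carrier n
    xˡ = x ∘ (_↑ˡ n)
    xʳ = x ∘ (n ↑ʳ_)
    ε = paritySign S
    A = contract (alternate xˡ) (λ U → Q (∁ S′ ++ U)) (∁ S)
    B = contract (alternate xʳ) (λ U → Q (U ++ ∁ S)) (∁ S′)
    -0≈0 : - 0# ≈ 0#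
    -0≈0 = solve 0 (:- con +0 := con +0) refl
    ε′≈-ε : paritySign (∁ S′) ≈ - ε
    ε′≈-ε = begin
      paritySign (∁ S′)                   ≈⟨ paritySign≈^ (∁ S′) ⟩
      (- 1#) ^ ∣ ∁ S′ ∣                   ≈⟨ solve 1 (λ s → s := :- ((:- con (+ 1)) :* s)) refl _ ⟩
      - ((- 1#) ^ suc ∣ ∁ S′ ∣)           ≡⟨ ≡.cong (λ l → - ((- 1#) ^ l)) card ⟨
      - ((- 1#) ^ ∣ S ∣)                  ≈⟨ -‿cong (paritySign≈^ S) ⟨
      - ε                                 ∎
    left : wedge xˡ (λ U → Q (ℛ n (U ++ S′))) S ≈ A
    left = begin
      wedge xˡ (λ U → Q (ℛ n (U ++ S′))) S
        ≈⟨ clifford-cong {n} (λ _ → refl) (λ _ → refl) (λ U → reflexive (≡.cong Q (ℛ-++ n U S′))) S ⟩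
      wedge xˡ ((λ U → Q (∁ S′ ++ U)) ∘ ∁) S
        ≈⟨ clifford-∁ xˡ (const 0#) (λ U → Q (∁ S′ ++ U)) S ⟩
      clifford (alternate (const 0#)) (alternate xˡ) (λ U → Q (∁ S′ ++ U)) (∁ S)
        ≈⟨ clifford-cong {n} (λ _ → zeroʳ _) (λ _ → refl) (λ _ → refl) (∁ S) ⟩
      A  ∎
    right : wedge xʳ (λ U → Q (ℛ n (S ++ U))) S′ ≈ B
    right = begin
      wedge xʳ (λ U → Q (ℛ n (S ++ U))) S′
        ≈⟨ clifford-cong {n} (λ _ → refl) (λ _ → refl) (λ U → reflexive (≡.cong Q (ℛ-++ n S U))) S′ ⟩
      wedge xʳ ((λ U → Q (U ++ ∁ S)) ∘ ∁) S′
        ≈⟨ clifford-∁ xʳ (const 0#) (λ U → Q (U ++ ∁ S)) S′ ⟩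
      clifford (alternate (const 0#)) (alternate xʳ) (λ U → Q (U ++ ∁ S)) (∁ S′)
        ≈⟨ clifford-cong {n} (λ _ → zeroʳ _) (λ _ → refl) (λ _ → refl) (∁ S′) ⟩
      B  ∎

  neg≈0 : ∀ {a} → - a ≈ 0# → a ≈ 0#
  neg≈0 {a} -a≈0 = trans (solve 1 (λ a → a := :- (:- a)) refl a)
    (trans (-‿cong -a≈0) (solve 0 (:- con +0 := con +0) refl))

  -- `contract-ω` read from right to left: its condition on the two halves amounts to `I` having n +
  -- 1 elements.
  wedge-ℛ≈0 : ∀ x Q → (∀ K → contract (ω x) Q K ≈ 0#) →
    ∀ I → ∣ I ∣ ≡ suc n → wedge x (Q ∘ ℛ n) I ≈ 0#
  wedge-ℛ≈0 x Q h I ∣I∣ with Vec.splitAt n I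
  ... | S , S′ , ≡.refl = sign-cancel (paritySign² S) (neg≈0 (trans
      (sym (contract-ω x Q S S′ card)) (h (∁ S′ ++ ∁ S))))
    where
    card : ∣ S ∣ ≡ suc ∣ ∁ S′ ∣
    card = ℕₚ.+-cancelˡ-≡ ∣ S′ ∣ _ _ (≡.trans (ℕₚ.+-comm ∣ S′ ∣ ∣ S ∣) (≡.trans (≡.sym (∣++∣ S S′))
      (≡.trans ∣I∣ (≡.trans (≡.cong suc (≡.sym (∣p∣+∣∁p∣≡n S′))) (≡.sym (ℕₚ.+-suc ∣ S′ ∣ ∣ ∁ S′ ∣))))))

  -- The converse passage: both halves of `K` are written as double complements, and size n - 1 for
  -- `K` becomes size n + 1 on the other side.
  contract-ω≈0 : ∀ x Q → (∀ I → ∣ I ∣ ≡ suc n → wedge x (Q ∘ ℛ n) I ≈ 0#) →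
    ∀ K → suc ∣ K ∣ ≡ n → contract (ω x) Q K ≈ 0#
  contract-ω≈0 x Q h K ∣K∣ with Vec.splitAt n K
  ... | U , U′ , ≡.refl = begin
      contract (ω x) Q (U ++ U′)
        ≡⟨ ≡.cong₂ (λ V V′ → contract (ω x) Q (V ++ V′)) (∁-involutive U) (∁-involutive U′) ⟨
      contract (ω x) Q (∁ (∁ U) ++ ∁ (∁ U′))
        ≈⟨ contract-ω x Q (∁ U′) (∁ U) (≡.trans card (≡.cong (suc ∘ ∣_∣) (≡.sym (∁-involutive U)))) ⟩
      - (paritySign (∁ U′) * wedge x (Q ∘ ℛ n) (∁ U′ ++ ∁ U))
        ≈⟨ -‿cong (*-congˡ (h (∁ U′ ++ ∁ U) total)) ⟩
      - (paritySign (∁ U′) * 0#)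
        ≈⟨ solve 1 (λ s → :- (s :* con +0) := con +0) refl _ ⟩
      0#  ∎
    where
    card : ∣ ∁ U′ ∣ ≡ suc ∣ U ∣
    card = ℕₚ.+-cancelˡ-≡ ∣ U′ ∣ _ _ (≡.trans (∣p∣+∣∁p∣≡n U′) (≡.trans (≡.sym ∣K∣)
      (≡.trans (≡.cong suc (≡.trans (∣++∣ U U′) (ℕₚ.+-comm ∣ U ∣ ∣ U′ ∣))) (≡.sym (ℕₚ.+-suc ∣ U′ ∣ ∣ U ∣)))))
    total : ∣ ∁ U′ ++ ∁ U ∣ ≡ suc n
    total = ≡.trans (∣++∣ (∁ U′) (∁ U)) (≡.trans (≡.cong (ℕ._+ ∣ ∁ U ∣) card) (≡.cong suc (∣p∣+∣∁p∣≡n U)))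

  -- The two inclusions

  module _ (X : Gr n (n ℕ.+ n)) where

    open Gr X
    open Represents represents
    private P = plücker matrix

    Δ≈ : ∀ I → Δ X I ≈ P (proj₁ I)
    Δ≈ = minor≈plücker matrix

    -- A vector of X that vanishes on T and off T ∪ ρ(T) is zero, since R pairs
    -- its coordinate at ρ(t) with the pivot at t.
    isotropic-extensible : LGᴿ n X → ∀ {k} {A : Matrix k (n ℕ.+ n)} {T} →
      (∀ i → A i ∈ᵛ subspace) → Transversal n T → Pivoted A T →
      ∀ y → y ∈ᵛ subspace → (∀ t → lookup T t ≡ inside → y t ≈ 0#) →
      (∀ j → lookup T j ≡ outside → Transversal n (T [ j ]≔ inside) → y j ≈ 0#) → ∀ j → y j ≈ 0#
    isotropic-extensible iso {A = A} {T} A∈ trv piv y y∈ y≈0 free = zero-at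
      where
      open Pivoted piv
      off : ∀ j → lookup T (ρ n j) ≡ outside → y j ≈ 0#
      off j ρj∉T with lookup T j in eq
      ... | inside  = y≈0 j eq
      ... | outside = free j eq (transversal-insert n T j trv eq ρj∉T)
      zero-at : ∀ j → y j ≈ 0#
      zero-at j with lookup T (ρ n j) in ρj∈T
      ... | outside = off j ρj∈T
      ... | inside  = sign-cancel (τ² j) (begin
        τ j * y j                    ≈⟨ *-congʳ (trans (*-congˡ (row-pivot (ρ n j) ρj∈T)) (*-identityʳ _)) ⟨
        ω r j * y j                  ≈⟨ sum-single (λ l → ω r l * y l) j other ⟨
        pairing (ω r) y              ≈⟨ pairing-ω r y ⟩
        R n r y                      ≈⟨ iso r y (span-least A subspace A∈ (row∈ (ρ n j) ρj∈T)) y∈ ⟩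
        0#                           ∎)
        where
        r = row (ρ n j)
        -- Either ρ(l) is not a pivot, and `y l` is already zero, or it is a pivot other than ρ(j),
        -- where the reduced row vanishes. Thus R(r, y) collapses to its term at `j`.
        other : ∀ l → l ≢ j → ω r l * y l ≈ 0#
        other l l≢j with lookup T (ρ n l) in ρl∈T
        ... | outside = trans (*-congˡ (off l ρl∈T)) (zeroʳ _)
        ... | inside  = trans (*-congʳ (trans (*-congˡ (row-other (ρ n j) (ρ n l) ρj∈T ρl∈T ρj≢ρl)) (zeroʳ _))) (zeroˡ _)
          where
          ρj≢ρl : ρ n j ≢ ρ n l
          ρj≢ρl eq = l≢j (≡.trans (≡.sym (ρ-involutive n l)) (≡.trans (≡.cong (ρ n) (≡.sym eq)) (ρ-involutive n j)))

    -- H p - p; the factor `1#` gives it the shape that `clifford-axmy` expects.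
    difference : Form (n ℕ.+ n)
    difference U = 1# * P (ℛ n U) - P U

    wedge-difference : ∀ x → x ∈ᵛ span matrix → ∀ I → wedge x difference I ≈ wedge x (P ∘ ℛ n) I
    wedge-difference x x∈ I = begin
      wedge x difference I                   ≈⟨ clifford-axmy x (const 0#) 1# (P ∘ ℛ n) P I ⟩
      1# * wedge x (P ∘ ℛ n) I - wedge x P I  ≈⟨ +-congˡ (-‿cong (wedge-span matrix x∈ I)) ⟩
      1# * wedge x (P ∘ ℛ n) I - 0#           ≈⟨ solve 1 (λ a → con (+ 1) :* a :- con +0 := a) refl _ ⟩
      wedge x (P ∘ ℛ n) I                     ∎

    isotropic⇒symmetric : LGᴿ n X → ∀ I → Δ X I ≈ Δ X (𝓡 I)
    -- Tightness replaces the equation by the refutation of an apartness, a negative goal in which a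
    -- pivot set may be assumed.
    isotropic⇒symmetric iso (S , ∣S∣≡n) = proj₁ (tight _ _) λ Δ#Δ →
      ¬¬∃-pivoted subspace (Transversal n) (transversal-⊥ n) (isotropic-extensible iso)
        matrix rows∈ independent λ { (T , trv , piv) →
          #-irrefl (equal piv (transversal-fixed n trv (Pivoted.card piv))) Δ#Δ }
      where
      killed : ∀ x → x ∈ᵛ span matrix → ∀ I → ∣ I ∣ ≡ suc n → wedge x difference I ≈ 0#
      killed x x∈ I ∣I∣ = trans (wedge-difference x x∈ I)
        (wedge-ℛ≈0 x P (contract-plücker matrix (ω x) λ i → trans (pairing-ω x (matrix i))
          (iso x (matrix i) (span-least matrix subspace rows∈ x∈) (rows∈ i))) I ∣I∣)
      equal : ∀ {T} → Pivoted matrix T → ℛ n T ≡ T → Δ X (S , ∣S∣≡n) ≈ Δ X (𝓡 (S , ∣S∣≡n))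
      equal {T} piv ℛT≡T = begin
        Δ X (S , ∣S∣≡n)       ≈⟨ Δ≈ (S , ∣S∣≡n) ⟩
        P S                   ≈⟨ solve 2 (λ a b → b := a :- (con (+ 1) :* a :- b)) refl (P (ℛ n S)) (P S) ⟩
        P (ℛ n S) - difference S
          ≈⟨ +-congˡ (-‿cong (determined-by-pivots piv difference killed
               (trans (+-congʳ (*-congˡ (reflexive (≡.cong P ℛT≡T))))
                  (solve 1 (λ a → con (+ 1) :* a :- a := con +0) refl (P T))) S ∣S∣≡n)) ⟩
        P (ℛ n S) - 0#        ≈⟨ solve 1 (λ a → a :- con +0 := a) refl _ ⟩
        P (ℛ n S)             ≈⟨ Δ≈ (𝓡 (S , ∣S∣≡n)) ⟨
        Δ X (𝓡 (S , ∣S∣≡n))   ∎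

    symmetric⇒isotropic : (∀ I → Δ X I ≈ Δ X (𝓡 I)) → LGᴿ n X
    symmetric⇒isotropic sym-Δ x z x∈X z∈X = proj₁ (tight _ _) λ R#0 →
      ¬¬∃-pivoted subspace (λ _ → ⊤) tt
        -- Any pivot set will do here: with the trivial invariant every column outside `T` is
        -- admissible, so nothing remains to be shown about isotropy.
        (λ {k} {A} {T} _ _ _ y _ y≈0 free j → everywhere T y y≈0 (λ j j∉ → free j j∉ tt) j)
        matrix rows∈ independent λ { (T , _ , piv) → #-irrefl (vanish piv) R#0 }
      where
      everywhere : ∀ (T : Subset (n ℕ.+ n)) (y : Vector Carrier (n ℕ.+ n)) →
        (∀ t → lookup T t ≡ inside → y t ≈ 0#) → (∀ t → lookup T t ≡ outside → y t ≈ 0#) → ∀ t → y t ≈ 0#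
      everywhere T y in≈0 out≈0 t with lookup T t in eq
      ... | inside  = in≈0 t eq
      ... | outside = out≈0 t eq
      x∈ : x ∈ᵛ span matrix
      x∈ = spanning x x∈X
      z∈ : z ∈ᵛ span matrix
      z∈ = spanning z z∈X
      difference≈0 : ∀ S → ∣ S ∣ ≡ n → difference S ≈ 0#
      difference≈0 S ∣S∣≡n = begin
        1# * P (ℛ n S) - P S  ≈⟨ +-congʳ (*-congˡ (trans (sym (Δ≈ (𝓡 (S , ∣S∣≡n)))) (trans (sym (sym-Δ (S , ∣S∣≡n))) (Δ≈ (S , ∣S∣≡n))))) ⟩
        1# * P S - P S        ≈⟨ solve 1 (λ a → con (+ 1) :* a :- a := con +0) refl _ ⟩
        0#                    ∎
      -- As x ∧ p = 0, the form `P ∘ ℛ n` may be replaced by `difference`, which vanishes on the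
      -- n-element sets that the expansion reaches.
      wedge≈0 : ∀ I → ∣ I ∣ ≡ suc n → wedge x (P ∘ ℛ n) I ≈ 0#
      wedge≈0 I ∣I∣ = trans (sym (wedge-difference x x∈ I)) (wedge-vanish x difference I λ j j∈I →
        trans (*-congˡ (difference≈0 (I [ j ]≔ outside) (ℕₚ.suc-injective (≡.trans (∣delete∣ I j j∈I) ∣I∣)))) (zeroʳ _))
      vanish : ∀ {T} → Pivoted matrix T → R n x z ≈ 0#
      vanish {T} piv = #0-unit-cancel nonzero (begin
        R n x z * P T
          ≈⟨ *-congʳ (trans (sym (pairing-ω x z)) (solve 1 (λ a → a := a :+ con +0) refl _)) ⟩
        (pairing (ω x) z + 0#) * P T
          ≈⟨ *-congʳ (+-congˡ (sum-zero {n ℕ.+ n} _ λ _ → zeroˡ 0#)) ⟨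
        -- The second pairing in the Clifford relation is between the zero covector of `wedge` and
        -- the zero vector of `contract`.
        (pairing (ω x) z + pairing {n ℕ.+ n} (const 0#) (const 0#)) * P T
          ≈⟨ clifford-anticomm (const 0#) (ω x) z (const 0#) P T ⟨
        contract (ω x) (wedge z P) T + wedge z (contract (ω x) P) T
          ≈⟨ +-cong
               (trans (clifford-cong {n ℕ.+ n} (λ _ → refl) (λ _ → refl) (wedge-span matrix z∈) T)
                      (contract-zero (ω x) T))
               -- Each term deletes an element of `T`, so the contraction is taken at n - 1
               -- elements, where it is known to vanish.
               (wedge-vanish z (contract (ω x) P) T λ j j∈T → trans
                  (*-congˡ (contract-ω≈0 x P wedge≈0 (T [ j ]≔ outside) (≡.trans (∣delete∣ T j j∈T) card)))
                  (zeroʳ _)) ⟩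
        0# + 0#
          ≈⟨ +-identityʳ 0# ⟩
        0#  ∎)
        where open Pivoted piv

  ≤-respʳ-≈ : ∀ {a b c} → b ≈ c → a ≤ b → a ≤ c
  ≤-respʳ-≈ b≈c a≤b c<a = a≤b (IsStrictPartialOrder.<-respˡ-≈ isStrictPartialOrder (sym b≈c) c<a)

proposition3p8 : ∀ {c ℓ₁ ℓ₂ : Level} (ℝ : RealNumbers c ℓ₁ ℓ₂) (n : ℕ) .{{_ : NonZero n}} →
    let open RealNumbers ℝ
        open Grassmannian ℝ
    in
    (LGᴿ n ≐ λ (X : Gr n (n +ℕ n)) →
       ∀ (I : kSubset n (n +ℕ n)) → Δ X I ≈ Δ X (𝓡 I))
    ×
    (LGᴿ≥0 n ≐ λ (X : Gr n (n +ℕ n)) →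
       ∃ λ t → t # 0# ×
         (∀ (I : kSubset n (n +ℕ n)) →
            t * Δ X I ≈ t * Δ X (𝓡 I) × 0# ≤ t * Δ X (𝓡 I)))
proposition3p8 ℝ n =
  ( (λ {X} → isotropic⇒symmetric X) , (λ {X} → symmetric⇒isotropic X) ) ,
  -- The inequality asked for at `I` is the hypothesis at `𝓡 I`.
  ( (λ {X} (iso , t , t#0 , 0≤tΔ) → t , t#0 , λ I →
        *-congˡ (isotropic⇒symmetric X iso I) , 0≤tΔ (𝓡 I))
  -- The scalar is apart from zero, so it cancels from the scaled symmetry.
  , (λ {X} (t , t#0 , h) →
        symmetric⇒isotropic X (λ I → #0-cancelˡ t#0 (proj₁ (h I)))
      , t , t#0 , λ I → ≤-respʳ-≈ (sym (proj₁ (h I))) (proj₂ (h I))) )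
  where
  open RealNumbers ℝ using (*-congˡ; sym)
  open Lagrangian ℝ n
  open Plücker ℝ using (#0-cancelˡ)
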